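{- Let $\phi\colon\mathbb{N}\to(0,1]$ be a decreasing function, let $\gamma\in(0,\tfrac12)$, let $N\in\mathbb{N}$, and let $\sigma\in\mathcal{L}_{wbal}(\phi,\gamma,N)$. Then, as $n\to\infty$, $$\mathbb{E}(H_{n,\sigma})\le\frac{1}{\log\bigl(\frac{1}{1-\gamma}\bigr)}\cdot\frac{\log\bigl(2\phi(n)^{ -1}(1+\phi(n))\bigr)}{\log(1+\phi(n))}\cdot(\log n)\,(1+o(1)).$$
   Context: $\mathbb{N}=\{1,2,3,\dots\}$; $\log$ is the binary logarithm $\log_2$. "Decreasing" is meant in the non-strict sense. Binary trees: $\mathcal{T}$ is the set of full binary trees, i.e. rooted ordered trees in which each node has either exactly two children (a left and a right one) or none. The size $|t|$ of $t\in\mathcal{T}$ is its number of leaves, and $\mathcal{T}_n$ is the set of $t\in\mathcal{T}$ with $|t|=n$. For $|t|\ge 2$, $t_\ell$ and $t_r$ denote the left and right subtrees at the root. The height is $h(t)=0$ if $|t|=1$ and $h(t)=1+\max(h(t_\ell),h(t_r))$ otherwise. Leaf-centric tree sources: $\mathcal{L}$ is the set of all functions $\sigma\colon\mathbb{N}\times\mathbb{N}\to[0,1]$ with $\sum_{i=1}^{k-1}\sigma(i,k-i)=1$ for every integer $k\ge 2$. For $\sigma\in\mathcal{L}$ define $P_\sigma\colon\mathcal{T}\to[0,1]$ by $P_\sigma(t)=1$ if $|t|=1$ and $P_\sigma(t)=\sigma(|t_\ell|,|t_r|)\cdot P_\sigma(t_\ell)\cdot P_\sigma(t_r)$ otherwise.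 For every $n\ge1$, $P_\sigma$ restricted to $\mathcal{T}_n$ is a probability mass function. $H_{n,\sigma}$ denotes the height of a random tree drawn from $\mathcal{T}_n$ according to $P_\sigma$, so $\mathbb{E}(H_{n,\sigma})=\sum_{t\in\mathcal{T}_n}P_\sigma(t)h(t)$. Weakly-balanced sources: $\mathcal{L}_{wbal}(\phi,\gamma,N)$ is the set of all $\sigma\in\mathcal{L}$ such that $\sum_{\gamma n\le k\le(1-\gamma)n}\sigma(k,n-k)\ge\phi(n)$ for every integer $n\ge N$ (the sum is over integers $k$). An inequality $a_n\le b_n(1+o(1))$ means that there is a real sequence $\varepsilon_n\to0$ with $a_n\le b_n(1+\varepsilon_n)$ for all sufficiently large $n$ (with $\sigma,\phi,\gamma,N$ fixed). -}

module Defs where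

open import Algebra.Bundles using (CommutativeRing; Semiring)
import Algebra.Definitions.RawSemiring as RawSemiringDefs
open import Data.Empty using (⊥)
open import Data.List.Base using (List; []; _∷_; applyUpTo; cartesianProductWith; concatMap; filter; foldr; upTo)
open import Data.List.Membership.Propositional using (_∈_; find; lose)
open import Data.List.Membership.Propositional.Properties
  using (∈-applyUpTo⁺; ∈-applyUpTo⁻; ∈-cartesianProductWith⁺; ∈-cartesianProductWith⁻; ∈-concatMap⁺; ∈-concatMap⁻)
open import Data.List.Relation.Unary.All as All using ([]; _∷_)
open import Data.List.Relation.Unary.AllPairs using ([]; _∷_)
import Data.List.Relation.Unary.All.Properties as All
import Data.List.Relation.Unary.AllPairs.Properties as AllPairs
open import Data.List.Relation.Unary.Any using (here)
open import Data.List.Relation.Unary.Unique.Propositional using (Unique)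
import Data.List.Relation.Unary.Unique.Propositional.Properties as Unique
open import Data.Nat.Base as ℕ using (ℕ; zero; suc; s≤s; _∸_; _⊔_)
import Data.Nat.Properties as ℕ
open import Data.Product.Base using (∃-syntax; _×_; _,_)
open import Data.Tree.Binary using (Tree; leaf; node; #leaves)
open import Data.Unit.Base using (⊤; tt)
open import Level using (Level)
open import Relation.Binary.Core using (Rel)
import Relation.Binary.Construct.NonStrictToStrict as Strict
open import Relation.Binary.PropositionalEquality.Core as ≡ using (_≡_)
open import Relation.Binary.Structures using (IsDecTotalOrder)
open import Relation.Nullary.Decidable using (_×-dec_)
open import Relation.Nullary.Negation using (¬_)
open import Relation.Unary using (Pred; Satisfiable)

------------------------------------------------------------------------
-- Real numbers

-- ℝ is axiomatised as the (up to isomorphism unique) complete ordered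
-- field.  The order is decidable, as it is classically.  The Archimedean
-- property follows classically from completeness; it is included so that
-- the natural number it promises is available as data.  _⁻¹ and sup are
-- total functions, about which nothing is assumed at zero, respectively
-- at predicates that are empty or unbounded above.

record RealField (ℓ : Level) : Set (Level.suc ℓ) where
  infix  8 _⁻¹
  infixl 7 _/_
  infix  4 _≤_ _≲_ _⟶0

  field
    commutativeRing : CommutativeRing ℓ ℓ

  open CommutativeRing commutativeRing public
  open RawSemiringDefs (Semiring.rawSemiring semiring) public using (_^_) renaming (_×_ to _·_)

  field
    _≤_             : Rel Carrier ℓ
    isDecTotalOrder : IsDecTotalOrder _≈_ _≤_
    +-monoʳ-≤       : ∀ x {y z} → y ≤ z → x + y ≤ x + z
    *-nonNegative   : ∀ {x y} → 0# ≤ x → 0# ≤ y → 0# ≤ x * y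

    0≉1             : ¬ 0# ≈ 1#
    _⁻¹             : Carrier → Carrier
    *-inverseʳ      : ∀ {x} → ¬ x ≈ 0# → x * x ⁻¹ ≈ 1#

    archimedean     : ∀ x → ∃[ n ] x ≤ n · 1#

  UpperBound : Pred Carrier ℓ → Pred Carrier ℓ
  UpperBound P u = ∀ {x} → P x → x ≤ u

  field
    sup             : Pred Carrier ℓ → Carrier
    sup-upper       : ∀ P → Satisfiable P → Satisfiable (UpperBound P) → UpperBound P (sup P)
    sup-least       : ∀ P → Satisfiable P → ∀ {u} → UpperBound P u → sup P ≤ u

  open IsDecTotalOrder isDecTotalOrder public
    using (_≤?_)
    renaming (refl to ≤-refl; reflexive to ≤-reflexive; trans to ≤-trans; antisym to ≤-antisym; total to ≤-total)

  open Strict _≈_ _≤_ public using (_<_)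

  ι : ℕ → Carrier
  ι n = n · 1#

  _/_ : Carrier → Carrier → Carrier
  x / y = x * y ⁻¹

  -- Binary logarithm of a positive x: the supremum of the rationals
  -- (a - b) / q such that 2 ^ ((a - b) / q) ≤ x, the latter written
  -- without negative or fractional exponents.
  log : Carrier → Carrier
  log x = sup λ r → ∃[ a ] ∃[ b ] ∃[ q ]
    1 ℕ.≤ q × ι q * r ≈ ι a - ι b × ι 2 ^ a ≤ ι 2 ^ b * x ^ q

  ∑ : ∀ {a} {A : Set a} → List A → (A → Carrier) → Carrier
  ∑ xs f = foldr (λ x s → f x + s) 0# xs

  infixl 6 ∑
  syntax ∑ xs (λ x → e) = ∑[ x ∈ xs ] e

  _⟶0 : (ℕ → Carrier) → Set ℓ
  ε ⟶0 = ∀ δ → 0# < δ → ∃[ M ] ∀ n → M ℕ.≤ n → - δ < ε n × ε n < δ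

  -- a n ≤ b n * (1 + o(1)) as n → ∞.
  _≲_ : (ℕ → Carrier) → (ℕ → Carrier) → Set ℓ
  a ≲ b = ∃[ ε ] ε ⟶0 × ∃[ M ] ∀ n → M ℕ.≤ n → a n ≤ b n * (1# + ε n)

------------------------------------------------------------------------
-- Full binary trees

𝒯 : Set
𝒯 = Tree ⊤ ⊤

∣_∣ : 𝒯 → ℕ
∣ t ∣ = #leaves t

height : 𝒯 → ℕ
height (leaf _)     = 0
height (node l _ r) = 1 ℕ.+ (height l ⊔ height r)

-- The integers i with 1 ≤ i ≤ k - 1.
[1‥_-1] : ℕ → List ℕ
[1‥ k -1] = applyUpTo suc (k ∸ 1)

-- The first argument bounds the recursion depth; the trees of size n
-- have height less than n, so for 𝒯[ n ] depth n is more than enough.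
treesOfSize : ℕ → ℕ → List 𝒯
treesOfSize _       0                 = []
treesOfSize _       1                 = leaf tt ∷ []
treesOfSize zero    (suc (suc _))     = []
treesOfSize (suc d) n@(suc (suc _))   =
  concatMap (λ i → cartesianProductWith (λ l r → node l tt r) (treesOfSize d i) (treesOfSize d (n ∸ i))) [1‥ n -1]

𝒯[_] : ℕ → List 𝒯
𝒯[ n ] = treesOfSize n n

-- 𝒯[ n ] lists each tree of size n exactly once, and no other tree.

private

  splits : ℕ → ℕ → ℕ → List 𝒯
  splits d n i = cartesianProductWith (λ l r → node l tt r) (treesOfSize d i) (treesOfSize d (n ∸ i))

  1≤∣_∣ : ∀ t → 1 ℕ.≤ ∣ t ∣
  1≤∣ leaf _ ∣     = ℕ.≤-refl
  1≤∣ node l _ r ∣ = ℕ.≤-trans 1≤∣ l ∣ (ℕ.m≤m+n _ _)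

  sound : ∀ d n {t} → t ∈ treesOfSize d n → ∣ t ∣ ≡ n
  splits-sound : ∀ d n i {t} → i ℕ.≤ n → t ∈ splits d n i →
                 ∃[ l ] ∃[ r ] t ≡ node l tt r × ∣ l ∣ ≡ i × ∣ t ∣ ≡ n

  sound _       1             (here ≡.refl) = ≡.refl
  sound (suc d) (suc (suc m)) t∈
    with i , i∈ , t∈i ← find (∈-concatMap⁻ (splits d (2 ℕ.+ m)) {xs = [1‥ 2 ℕ.+ m -1]} t∈)
    with _ , k<m , ≡.refl ← ∈-applyUpTo⁻ suc i∈
       = let _ , _ , _ , _ , eq = splits-sound d (2 ℕ.+ m) i (s≤s (ℕ.<⇒≤ k<m)) t∈i in eq

  splits-sound d n i i≤n t∈
    with l , r , l∈ , r∈ , ≡.refl ← ∈-cartesianProductWith⁻ (λ l r → node l tt r) (treesOfSize d i) (treesOfSize d (n ∸ i)) t∈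
       = l , r , ≡.refl , sound d i l∈
       , ≡.trans (≡.cong₂ ℕ._+_ (sound d i l∈) (sound d (n ∸ i) r∈)) (ℕ.m+[n∸m]≡n i≤n)

  complete : ∀ d n t → ∣ t ∣ ≡ n → n ℕ.≤ suc d → t ∈ treesOfSize d n
  complete d 0 t eq _ with () ← ≡.subst (1 ℕ.≤_) eq 1≤∣ t ∣
  complete d 1 (leaf tt) _ _ = here ≡.refl
  complete d 1 (node l _ r) eq _
    with s≤s () ← ≡.subst (2 ℕ.≤_) eq (ℕ.+-mono-≤ 1≤∣ l ∣ 1≤∣ r ∣)
  complete zero    (suc (suc _)) _ _ (s≤s ())
  complete (suc d) n@(suc (suc m)) (node l tt r) eq (s≤s n≤d) =
    ∈-concatMap⁺ (splits d n) (lose l∈ (∈-cartesianProductWith⁺ (λ l r → node l tt r)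
      (complete d ∣ l ∣ l ≡.refl (ℕ.≤-trans (ℕ.s≤s⁻¹ l<n) n≤d))
      (complete d (n ∸ ∣ l ∣) r r≡ (ℕ.≤-trans (ℕ.s≤s⁻¹ r<n) n≤d))))
    where
    l<n : ∣ l ∣ ℕ.< n
    l<n = ≡.subst (∣ l ∣ ℕ.<_) eq (ℕ.m<m+n ∣ l ∣ 1≤∣ r ∣)
    r≡ : ∣ r ∣ ≡ n ∸ ∣ l ∣
    r≡ = ≡.trans (≡.sym (ℕ.m+n∸m≡n ∣ l ∣ ∣ r ∣)) (≡.cong (_∸ ∣ l ∣) eq)
    r<n : n ∸ ∣ l ∣ ℕ.< n
    r<n = ≡.subst (ℕ._< n) r≡ (≡.subst (∣ r ∣ ℕ.<_) eq (ℕ.m<n+m ∣ r ∣ 1≤∣ l ∣))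
    suc-pred : ∀ {k} → 1 ℕ.≤ k → suc (k ∸ 1) ≡ k
    suc-pred (s≤s _) = ≡.refl
    l∈ : ∣ l ∣ ∈ [1‥ n -1]
    l∈ = ≡.subst (_∈ [1‥ n -1]) (suc-pred 1≤∣ l ∣)
           (∈-applyUpTo⁺ suc (≡.subst (ℕ._≤ suc m) (≡.sym (suc-pred 1≤∣ l ∣)) (ℕ.s≤s⁻¹ l<n)))

  unique : ∀ d n → Unique (treesOfSize d n)
  unique _       0                = []
  unique _       1                = [] ∷ []
  unique zero    (suc (suc _))    = []
  unique (suc d) n@(suc (suc m))  = Unique.concat⁺
    (All.map⁺ (All.universal (λ i → Unique.cartesianProductWith⁺ _ (λ { ≡.refl → ≡.refl , ≡.refl })
                                       (unique d i) (unique d (n ∸ i))) [1‥ n -1]))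
    (AllPairs.map⁺ (AllPairs.applyUpTo⁺₁ suc (suc m) λ {i} {j} i<j j<m (t∈i , t∈j) →
      disjoint i<j (splits-sound d n (suc i) (s≤s (ℕ.<⇒≤ (ℕ.<-trans i<j j<m))) t∈i)
                   (splits-sound d n (suc j) (s≤s (ℕ.<⇒≤ j<m)) t∈j)))
    where
    disjoint : ∀ {i j t} → i ℕ.< j →
               (∃[ l ] ∃[ r ] t ≡ node l tt r × ∣ l ∣ ≡ suc i × ∣ t ∣ ≡ n) →
               (∃[ l ] ∃[ r ] t ≡ node l tt r × ∣ l ∣ ≡ suc j × ∣ t ∣ ≡ n) → ⊥
    disjoint i<j (_ , _ , ≡.refl , p , _) (_ , _ , ≡.refl , q , _) =
      ℕ.<⇒≢ i<j (ℕ.suc-injective (≡.trans (≡.sym p) q))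

∈-𝒯⇒size : ∀ {n t} → t ∈ 𝒯[ n ] → ∣ t ∣ ≡ n
∈-𝒯⇒size {n} = sound n n

size⇒∈-𝒯 : ∀ {n t} → ∣ t ∣ ≡ n → t ∈ 𝒯[ n ]
size⇒∈-𝒯 {n} {t} eq = complete n n t eq (ℕ.n≤1+n n)

𝒯-unique : ∀ n → Unique 𝒯[ n ]
𝒯-unique n = unique n n

------------------------------------------------------------------------
-- Leaf-centric tree sources

-- Functions on the positive integers are represented by functions on ℕ;
-- their values at 0 are unconstrained and never used.

module TreeSource {ℓ} (ℝ : RealField ℓ) where

  open RealField ℝ

  record ℒ (σ : ℕ → ℕ → Carrier) : Set ℓ where
    field
      in[0,1] : ∀ i j → 1 ℕ.≤ i → 1 ℕ.≤ j → 0# ≤ σ i j × σ i j ≤ 1#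
      sum≈1   : ∀ k → 2 ℕ.≤ k → ∑[ i ∈ [1‥ k -1] ] σ i (k ∸ i) ≈ 1#

  P : (ℕ → ℕ → Carrier) → 𝒯 → Carrier
  P σ (leaf _)     = 1#
  P σ (node l _ r) = σ ∣ l ∣ ∣ r ∣ * P σ l * P σ r

  𝔼[H] : (ℕ → ℕ → Carrier) → ℕ → Carrier
  𝔼[H] σ n = ∑[ t ∈ 𝒯[ n ] ] (P σ t * ι (height t))

  -- The integers k with γ n ≤ k ≤ (1 - γ) n.  For 0 ≤ γ all of them lie
  -- between 0 and n.
  balancedSplits : Carrier → ℕ → List ℕ
  balancedSplits γ n = filter (λ k → (γ * ι n ≤? ι k) ×-dec (ι k ≤? (1# - γ) * ι n)) (upTo (suc n))

  record ℒ-wbal (φ : ℕ → Carrier) (γ : Carrier) (N : ℕ) (σ : ℕ → ℕ → Carrier) : Set ℓ where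
    field
      leafCentric : ℒ σ
      balanced    : ∀ n → N ℕ.≤ n → φ n ≤ ∑[ k ∈ balancedSplits γ n ] σ k (n ∸ k)

-- Fix n, let p = φ(n), x = 1 + p, β = x / p, and let level k be the least j with (1 - γ)^j k ≤ 1.  With
-- F(k) = k x^min(k,N) β^(level k), the root recursion E x^H(k) ≤ x Σ σ(i,k-i) (E x^H(i) + E x^H(k-i)) gives
-- E x^H(k) ≤ F(k) for all k ≤ n: an arbitrary split costs a factor x, a γ-balanced one lowers both levels and
-- gains a factor x / β = p, and x (1 - q) + p q ≤ 1 as soon as the balanced splits have weight q ≥ p.
-- By Bernoulli's inequality H ≤ m + x^(H-m) / p, so E H(n) ≤ m + 1 for the least m with x^m ≥ F(n) / p.  Taking
-- logarithms, m log x ≤ log n + level(n) log β + O(log (2 β)), where level(n) ≤ log n / log (1/(1-γ)) + 1,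
-- and log n + level(n) log β is absorbed by log (2 β) = 1 + log β because log (1/(1-γ)) ≤ 1.  The error is
-- O(1 / log n) relative to the main term.

module Submission where

open import Defs
import Algebra.Properties.AbelianGroup
import Algebra.Properties.CommutativeSemiring.Exp
import Algebra.Properties.Ring
import Algebra.Properties.Semiring.Exp
import Algebra.Properties.Semiring.Mult
import Algebra.Solver.Ring.NaturalCoefficients.Default
open import Data.List.Base using (List; []; _∷_; _++_; _∷ʳ_; applyUpTo; cartesianProductWith; concatMap; filter; map)
import Data.List.Properties as List
open import Data.List.Relation.Unary.All as All using (All; []; _∷_)
import Data.List.Relation.Unary.All.Properties as All
open import Data.Nat.Base as ℕ using (ℕ; suc; z≤n; s≤s; _∸_; _⊓_)
import Data.Nat.Properties as ℕ
open import Data.Product.Base using (∃-syntax; _×_; _,_; proj₁; proj₂)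
open import Data.Sum.Base using (inj₁; inj₂; [_,_]′)
open import Data.Tree.Binary using (leaf; node)
open import Data.Unit.Base using (tt)
open import Function.Base using (_∘_)
open import Level using (Level)
open import Relation.Binary.Bundles using (Poset)
import Relation.Binary.Construct.NonStrictToStrict as Strict
open import Relation.Binary.PropositionalEquality as ≡ using (_≡_)
open import Relation.Binary.Structures using (IsDecTotalOrder)
import Relation.Binary.Reasoning.PartialOrder
open import Relation.Nullary.Decidable using (yes; no; _×-dec_)
open import Relation.Nullary.Negation using (¬_; contradiction)
open import Relation.Unary using (Pred; Decidable)

-- Ordered-field arithmetic, powers and the embedding of the natural numbers.

module OrderedField {ℓ} (ℝ : RealField ℓ) where

  open RealField ℝ hiding (zero)
  open IsDecTotalOrder isDecTotalOrder using (isPartialOrder)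

  open Algebra.Properties.Semiring.Exp semiring public using (^-homo-*; ^-assocʳ; ^-congˡ)
  open Algebra.Properties.CommutativeSemiring.Exp commutativeSemiring public using (^-distrib-*)
  open Algebra.Properties.Semiring.Mult semiring public using (×-homo-+; ×1-homo-*)
  open Algebra.Properties.Ring ring public using (-‿distribˡ-*; x[y-z]≈xy-xz)
  open Algebra.Properties.AbelianGroup +-abelianGroup public using () renaming (⁻¹-involutive to -‿involutive)
  open Algebra.Solver.Ring.NaturalCoefficients.Default commutativeSemiring public
    using (solve; _:=_; _:+_; _:*_; con)

  poset : Poset ℓ ℓ ℓ
  poset = record { isPartialOrder = isPartialOrder }

  module ≤-Reasoning = Relation.Binary.Reasoning.PartialOrder poset
  open ≤-Reasoning

  ≰⇒≥ : ∀ {x y} → ¬ x ≤ y → y ≤ x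
  ≰⇒≥ {x} {y} x≰y with ≤-total x y
  ... | inj₁ x≤y = contradiction x≤y x≰y
  ... | inj₂ y≤x = y≤x

  ≰⇒> : ∀ {x y} → ¬ x ≤ y → y < x
  ≰⇒> x≰y = ≰⇒≥ x≰y , λ y≈x → x≰y (≤-reflexive (sym y≈x))

  <⇒≱ : ∀ {x y} → x < y → ¬ y ≤ x
  <⇒≱ = Strict.<⇒≱ _≈_ _≤_ ≤-antisym

  <-≤-trans : ∀ {x y z} → x < y → y ≤ z → x < z
  <-≤-trans x<y y≤z = ≰⇒> λ z≤x → <⇒≱ x<y (≤-trans y≤z z≤x)

  ≤-<-trans : ∀ {x y z} → x ≤ y → y < z → x < z
  ≤-<-trans x≤y y<z = ≰⇒> λ z≤x → <⇒≱ y<z (≤-trans z≤x x≤y)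

  +-mono-≤ : ∀ {x y u v} → x ≤ y → u ≤ v → x + u ≤ y + v
  +-mono-≤ {x} {y} {u} {v} x≤y u≤v = begin
    x + u ≤⟨ +-monoʳ-≤ x u≤v ⟩
    x + v ≈⟨ +-comm x v ⟩
    v + x ≤⟨ +-monoʳ-≤ v x≤y ⟩
    v + y ≈⟨ +-comm v y ⟩
    y + v ∎

  +-monoˡ-≤ : ∀ x {y z} → y ≤ z → y + x ≤ z + x
  +-monoˡ-≤ x y≤z = +-mono-≤ y≤z ≤-refl

  +-cancelˡ-≤ : ∀ x {y z} → x + y ≤ x + z → y ≤ z
  +-cancelˡ-≤ x {y} {z} x+y≤x+z = begin
    y             ≈⟨ shift y ⟨
    - x + (x + y) ≤⟨ +-monoʳ-≤ (- x) x+y≤x+z ⟩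
    - x + (x + z) ≈⟨ shift z ⟩
    z             ∎
    where
    shift : ∀ w → - x + (x + w) ≈ w
    shift w = trans (sym (+-assoc _ _ _)) (trans (+-congʳ (-‿inverseˡ x)) (+-identityˡ w))

  x-y+y≈x : ∀ x y → x - y + y ≈ x
  x-y+y≈x x y = trans (+-assoc _ _ _) (trans (+-congˡ (-‿inverseˡ y)) (+-identityʳ x))

  x-y≤z⇒x≤z+y : ∀ {x y z} → x - y ≤ z → x ≤ z + y
  x-y≤z⇒x≤z+y {x} {y} p = ≤-trans (≤-reflexive (sym (x-y+y≈x x y))) (+-monoˡ-≤ y p)

  x≤z+y⇒x-y≤z : ∀ {x y z} → x ≤ z + y → x - y ≤ z
  x≤z+y⇒x-y≤z {x} {y} {z} p = +-cancelˡ-≤ y (begin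
    y + (x - y) ≈⟨ +-comm _ _ ⟩
    x - y + y   ≈⟨ x-y+y≈x x y ⟩
    x           ≤⟨ p ⟩
    z + y       ≈⟨ +-comm _ _ ⟩
    y + z       ∎)

  x≤y⇒0≤y-x : ∀ {x y} → x ≤ y → 0# ≤ y - x
  x≤y⇒0≤y-x {x} {y} x≤y = +-cancelˡ-≤ x (begin
    x + 0#      ≈⟨ +-identityʳ x ⟩
    x           ≤⟨ x≤y ⟩
    y           ≈⟨ x-y+y≈x y x ⟨
    y - x + x   ≈⟨ +-comm _ _ ⟩
    x + (y - x) ∎)

  x≤x+y : ∀ {x y} → 0# ≤ y → x ≤ x + y
  x≤x+y {x} {y} 0≤y = begin
    x      ≈⟨ +-identityʳ x ⟨
    x + 0# ≤⟨ +-monoʳ-≤ x 0≤y ⟩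
    x + y  ∎

  x≤y+x : ∀ {x y} → 0# ≤ y → x ≤ y + x
  x≤y+x 0≤y = ≤-trans (x≤x+y 0≤y) (≤-reflexive (+-comm _ _))

  +-nonNegative : ∀ {x y} → 0# ≤ x → 0# ≤ y → 0# ≤ x + y
  +-nonNegative 0≤x 0≤y = ≤-trans 0≤x (x≤x+y 0≤y)

  *-monoˡ-≤ : ∀ {x y z} → 0# ≤ x → y ≤ z → x * y ≤ x * z
  *-monoˡ-≤ {x} {y} {z} 0≤x y≤z = begin
    x * y                   ≤⟨ x≤y+x (*-nonNegative 0≤x (x≤y⇒0≤y-x y≤z)) ⟩
    x * (z - y) + x * y     ≈⟨ distribˡ x _ _ ⟨
    x * (z - y + y)         ≈⟨ *-congˡ (x-y+y≈x z y) ⟩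
    x * z                   ∎

  *-monoʳ-≤ : ∀ {x y z} → 0# ≤ x → y ≤ z → y * x ≤ z * x
  *-monoʳ-≤ {x} {y} {z} 0≤x y≤z = begin
    y * x ≈⟨ *-comm y x ⟩
    x * y ≤⟨ *-monoˡ-≤ 0≤x y≤z ⟩
    x * z ≈⟨ *-comm x z ⟩
    z * x ∎

  *-mono-≤ : ∀ {x y u v} → 0# ≤ x → 0# ≤ v → x ≤ y → u ≤ v → x * u ≤ y * v
  *-mono-≤ 0≤x 0≤v x≤y u≤v = ≤-trans (*-monoˡ-≤ 0≤x u≤v) (*-monoʳ-≤ 0≤v x≤y)

  -- By totality only the case 1 ≤ 0 needs work: then -1 is nonnegative, and so is its square 1.
  0≤1 : 0# ≤ 1#
  0≤1 with ≤-total 0# 1#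
  ... | inj₁ 0≤1 = 0≤1
  ... | inj₂ 1≤0 = begin
    0#          ≤⟨ *-nonNegative 0≤-1 0≤-1 ⟩
    - 1# * - 1# ≈⟨ -‿distribˡ-* _ _ ⟨
    - (1# * - 1#) ≈⟨ -‿cong (*-identityˡ _) ⟩
    - - 1#      ≈⟨ -‿involutive 1# ⟩
    1#          ∎
    where
    0≤-1 : 0# ≤ - 1#
    0≤-1 = ≤-trans (x≤y⇒0≤y-x 1≤0) (≤-reflexive (+-identityˡ _))

  0<1 : 0# < 1#
  0<1 = 0≤1 , 0≉1

  >⇒≉ : ∀ {x} → 0# < x → ¬ x ≈ 0#
  >⇒≉ (_ , 0≉x) x≈0 = 0≉x (sym x≈0)

  *-inverseˡ : ∀ {x} → 0# < x → x ⁻¹ * x ≈ 1#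
  *-inverseˡ 0<x = trans (*-comm _ _) (*-inverseʳ (>⇒≉ 0<x))

  ⁻¹-pos : ∀ {x} → 0# < x → 0# < x ⁻¹
  ⁻¹-pos {x} 0<x = ≰⇒> λ x⁻¹≤0 → <⇒≱ 0<1 (begin
    1#       ≈⟨ *-inverseʳ (>⇒≉ 0<x) ⟨
    x * x ⁻¹ ≤⟨ *-monoˡ-≤ (proj₁ 0<x) x⁻¹≤0 ⟩
    x * 0#   ≈⟨ zeroʳ x ⟩
    0#       ∎)

  *-cancelˡ-≤ : ∀ {x y z} → 0# < x → x * y ≤ x * z → y ≤ z
  *-cancelˡ-≤ {x} {y} {z} 0<x xy≤xz = begin
    y              ≈⟨ shift y ⟨
    x ⁻¹ * (x * y) ≤⟨ *-monoˡ-≤ (proj₁ (⁻¹-pos 0<x)) xy≤xz ⟩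
    x ⁻¹ * (x * z) ≈⟨ shift z ⟩
    z              ∎
    where
    shift : ∀ w → x ⁻¹ * (x * w) ≈ w
    shift w = trans (sym (*-assoc _ _ _)) (trans (*-congʳ (*-inverseˡ 0<x)) (*-identityˡ w))

  *-cancelˡ-< : ∀ {x y z} → 0# ≤ x → x * y < x * z → y < z
  *-cancelˡ-< 0≤x xy<xz = ≰⇒> λ z≤y → <⇒≱ xy<xz (*-monoˡ-≤ 0≤x z≤y)

  *-pos : ∀ {x y} → 0# < x → 0# < y → 0# < x * y
  *-pos {x} {y} 0<x 0<y = ≰⇒> λ xy≤0 →
    <⇒≱ 0<y (*-cancelˡ-≤ 0<x (≤-trans xy≤0 (≤-reflexive (sym (zeroʳ x)))))

  x*y⁻¹*y≈x : ∀ {x y} → 0# < y → x * y ⁻¹ * y ≈ x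
  x*y⁻¹*y≈x 0<y = trans (*-assoc _ _ _) (trans (*-congˡ (*-inverseˡ 0<y)) (*-identityʳ _))

  1≤* : ∀ {x y} → 1# ≤ x → 1# ≤ y → 1# ≤ x * y
  1≤* 1≤x 1≤y = ≤-trans (≤-reflexive (sym (*-identityˡ 1#)))
    (*-mono-≤ 0≤1 (≤-trans 0≤1 1≤y) 1≤x 1≤y)

  1≤⁻¹ : ∀ {x} → 0# < x → x ≤ 1# → 1# ≤ x ⁻¹
  1≤⁻¹ {x} 0<x x≤1 = *-cancelˡ-≤ 0<x (begin
    x * 1#   ≈⟨ *-identityʳ x ⟩
    x        ≤⟨ x≤1 ⟩
    1#       ≈⟨ *-inverseʳ (>⇒≉ 0<x) ⟨
    x * x ⁻¹ ∎)

  ^-nonNegative : ∀ {x} n → 0# ≤ x → 0# ≤ x ^ n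
  ^-nonNegative 0       0≤x = 0≤1
  ^-nonNegative (suc n) 0≤x = *-nonNegative 0≤x (^-nonNegative n 0≤x)

  ^-pos : ∀ {x} n → 0# < x → 0# < x ^ n
  ^-pos 0       0<x = 0<1
  ^-pos (suc n) 0<x = *-pos 0<x (^-pos n 0<x)

  1≤^ : ∀ {x} n → 1# ≤ x → 1# ≤ x ^ n
  1≤^ 0       1≤x = ≤-refl
  1≤^ (suc n) 1≤x = 1≤* 1≤x (1≤^ n 1≤x)

  ^-monoˡ-≤ : ∀ {x y} n → 0# ≤ x → x ≤ y → x ^ n ≤ y ^ n
  ^-monoˡ-≤ 0       0≤x x≤y = ≤-refl
  ^-monoˡ-≤ (suc n) 0≤x x≤y =
    *-mono-≤ 0≤x (^-nonNegative n (≤-trans 0≤x x≤y)) x≤y (^-monoˡ-≤ n 0≤x x≤y)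

  ^-monoʳ-≤ : ∀ {x m n} → 1# ≤ x → m ℕ.≤ n → x ^ m ≤ x ^ n
  ^-monoʳ-≤ {n = n} 1≤x z≤n       = 1≤^ n 1≤x
  ^-monoʳ-≤         1≤x (s≤s m≤n) = *-monoˡ-≤ (≤-trans 0≤1 1≤x) (^-monoʳ-≤ 1≤x m≤n)

  -- If n < m, then x^(n+1) ≤ x^m ≤ x^n, and cancelling x^n gives x ≤ 1.
  ^-cancelʳ-≤ : ∀ {x} m n → 1# < x → x ^ m ≤ x ^ n → m ℕ.≤ n
  ^-cancelʳ-≤ {x} m n 1<x x^m≤x^n with m ℕ.≤? n
  ... | yes m≤n = m≤n
  ... | no  m≰n = contradiction x≤1 (<⇒≱ 1<x)
    where
    0<x : 0# < x
    0<x = <-≤-trans 0<1 (proj₁ 1<x)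
    x≤1 : x ≤ 1#
    x≤1 = *-cancelˡ-≤ (^-pos n 0<x) (begin
      x ^ n * x  ≈⟨ *-comm _ _ ⟩
      x ^ suc n  ≤⟨ ^-monoʳ-≤ (proj₁ 1<x) (ℕ.≰⇒> m≰n) ⟩
      x ^ m      ≤⟨ x^m≤x^n ⟩
      x ^ n      ≈⟨ *-identityʳ _ ⟨
      x ^ n * 1# ∎)

  0≤ι : ∀ n → 0# ≤ ι n
  0≤ι 0       = ≤-refl
  0≤ι (suc n) = +-nonNegative 0≤1 (0≤ι n)

  ι-mono-≤ : ∀ {m n} → m ℕ.≤ n → ι m ≤ ι n
  ι-mono-≤ {n = n} z≤n = 0≤ι n
  ι-mono-≤ (s≤s m≤n)   = +-monoʳ-≤ 1# (ι-mono-≤ m≤n)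

  1≤ι : ∀ {n} → 1 ℕ.≤ n → 1# ≤ ι n
  1≤ι 1≤n = ≤-trans (≤-reflexive (sym (+-identityʳ 1#))) (ι-mono-≤ 1≤n)

  0<ι : ∀ {n} → 1 ℕ.≤ n → 0# < ι n
  0<ι 1≤n = <-≤-trans 0<1 (1≤ι 1≤n)

  ι-homo-+ : ∀ m n → ι (m ℕ.+ n) ≈ ι m + ι n
  ι-homo-+ = ×-homo-+ 1#

  ι-homo-* : ∀ m n → ι (m ℕ.* n) ≈ ι m * ι n
  ι-homo-* = ×1-homo-*

  ι-homo-^ : ∀ k → ι (2 ℕ.^ k) ≈ ι 2 ^ k
  ι-homo-^ 0       = +-identityʳ 1#
  ι-homo-^ (suc k) = trans (ι-homo-* 2 (2 ℕ.^ k)) (*-congˡ (ι-homo-^ k))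

  x<1+x : ∀ x → x < 1# + x
  x<1+x x = ≰⇒> λ 1+x≤x → <⇒≱ 0<1 (+-cancelˡ-≤ x (begin
    x + 1# ≈⟨ +-comm _ _ ⟩
    1# + x ≤⟨ 1+x≤x ⟩
    x      ≈⟨ +-identityʳ x ⟨
    x + 0# ∎))

  1<2 : 1# < ι 2
  1<2 = <-≤-trans (x<1+x 1#) (+-monoʳ-≤ 1# (1≤ι ℕ.≤-refl))

  -- In the induction step, (1 + p)(1 + n p) exceeds 1 + (n + 1) p by the nonnegative term n p².
  bernoulli : ∀ {p} n → 0# ≤ p → 1# + ι n * p ≤ (1# + p) ^ n
  bernoulli {p} 0 0≤p = ≤-reflexive (trans (+-congˡ (zeroˡ p)) (+-identityʳ 1#))
  bernoulli {p} (suc n) 0≤p = begin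
    1# + (1# + ι n) * p                     ≤⟨ x≤x+y (*-nonNegative (0≤ι n) (*-nonNegative 0≤p 0≤p)) ⟩
    1# + (1# + ι n) * p + ι n * (p * p)     ≈⟨ solve 2 (λ i p → con 1 :+ (con 1 :+ i) :* p :+ i :* (p :* p) := (con 1 :+ p) :* (con 1 :+ i :* p)) refl (ι n) p ⟩
    (1# + p) * (1# + ι n * p)               ≤⟨ *-monoˡ-≤ (+-nonNegative 0≤1 0≤p) (bernoulli n 0≤p) ⟩
    (1# + p) * (1# + p) ^ n                 ∎

-- Linear search upwards from 0; the witness `n` bounds the recursion.
least : ∀ {ℓ} {P : Pred ℕ ℓ} → Decidable P → ∀ n → P n → ∃[ m ] P m × (∀ k → P k → m ℕ.≤ k)
least P? n Pn with P? 0
least P? n       Pn | yes P0 = 0 , P0 , λ _ _ → z≤n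
least P? 0       P0 | no ¬P0 = contradiction P0 ¬P0
least P? (suc n) Pn | no ¬P0 with m , Pm , m-min ← least (P? ∘ suc) n Pn =
  suc m , Pm , λ { 0 P0 → contradiction P0 ¬P0 ; (suc k) Pk → s≤s (m-min k Pk) }

-- Integer rounding of logarithms, and the laws of `log` derived from it.

module Logarithm {ℓ} (ℝ : RealField ℓ) where

  open RealField ℝ hiding (zero)
  open OrderedField ℝ
  open ≤-Reasoning

  archimedean-* : ∀ {x} → 0# < x → ∀ z → ∃[ n ] z ≤ ι n * x
  archimedean-* {x} 0<x z with n , z/x≤n ← archimedean (z / x) = n , (begin
    z             ≈⟨ x*y⁻¹*y≈x 0<x ⟨
    z * x ⁻¹ * x  ≤⟨ *-monoʳ-≤ (proj₁ 0<x) z/x≤n ⟩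
    ι n * x       ∎)

  -- The Archimedean property gives n with z ≤ n (y - 1), and Bernoulli's inequality turns this into
  -- z ≤ y^n. Since the order is decidable, the least such exponent can be searched for.
  ⌈log⌉ : ∀ {y} → 1# < y → ∀ z → ∃[ m ] z ≤ y ^ m × (∀ k → z ≤ y ^ k → m ℕ.≤ k)
  ⌈log⌉ {y} 1<y z = least (λ k → z ≤? y ^ k) n (begin
    z                    ≤⟨ z≤n*[y-1] ⟩
    ι n * (y - 1#)       ≤⟨ x≤y+x 0≤1 ⟩
    1# + ι n * (y - 1#)  ≤⟨ bernoulli n (proj₁ 0<y-1) ⟩
    (1# + (y - 1#)) ^ n  ≈⟨ ^-congˡ n (trans (+-comm _ _) (x-y+y≈x y 1#)) ⟩
    y ^ n                ∎)
    where
    0<y-1 : 0# < y - 1#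
    0<y-1 = ≰⇒> λ y-1≤0 → <⇒≱ 1<y (≤-trans (x-y≤z⇒x≤z+y y-1≤0) (≤-reflexive (+-identityˡ 1#)))
    n = proj₁ (archimedean-* 0<y-1 z)
    z≤n*[y-1] = proj₂ (archimedean-* 0<y-1 z)

  -- By minimality the exponent one below still fails, so rounding up costs at most one factor y.
  -- The exponent 0 has no predecessor; there 1 ≤ z is used.
  y^⌈log⌉≤y*z : ∀ {y} (1<y : 1# < y) {z} → 1# ≤ z → y ^ proj₁ (⌈log⌉ 1<y z) ≤ y * z
  y^⌈log⌉≤y*z {y} 1<y {z} 1≤z with ⌈log⌉ 1<y z
  ... | 0     , _ , _     = 1≤* (proj₁ 1<y) 1≤z
  ... | suc m , _ , m-min = *-monoˡ-≤ (≤-trans 0≤1 (proj₁ 1<y))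
    (≰⇒≥ λ z≤y^m → ℕ.1+n≰n (m-min m z≤y^m))

  -- Only logarithms of reals z ≥ 1 occur; for these z the exponent 0 is admissible in the supremum.
  module _ {z} (1≤z : 1# ≤ z) where

    private
      -- Repeats the predicate in the definition of `log`, so that `log z` is `sup Exponents` by
      -- definition.
      Exponents : Pred Carrier ℓ
      Exponents r = ∃[ a ] ∃[ b ] ∃[ q ]
        1 ℕ.≤ q × ι q * r ≈ ι a - ι b × ι 2 ^ a ≤ ι 2 ^ b * z ^ q

      -- Raising 2^a′ ≤ 2^b′ z^q′ to the power q and z^q ≤ 2^a to the power q′ eliminates z.
      -- Comparing the exponents of 2 gives a′ q ≤ b′ q + a q′, which is r ≤ a / q after division by
      -- q q′.
      exponent-bound : ∀ a q → 1 ℕ.≤ q → z ^ q ≤ ι 2 ^ a → ∀ {r} → Exponents r → r ≤ ι a * ι q ⁻¹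
      exponent-bound a q 1≤q z^q≤2^a {r} (a′ , b′ , q′ , 1≤q′ , q′r≈ , 2^a′≤) =
        *-cancelˡ-≤ (*-pos (0<ι 1≤q) (0<ι 1≤q′)) (begin
          ι q * ι q′ * r               ≈⟨ *-assoc _ _ _ ⟩
          ι q * (ι q′ * r)             ≈⟨ *-congˡ q′r≈ ⟩
          ι q * (ι a′ - ι b′)          ≈⟨ x[y-z]≈xy-xz _ _ _ ⟩
          ι q * ι a′ - ι q * ι b′      ≤⟨ x≤z+y⇒x-y≤z qa′≤ ⟩
          ι q′ * ι a                   ≈⟨ *-identityʳ _ ⟨
          ι q′ * ι a * 1#              ≈⟨ *-congˡ (*-inverseʳ (>⇒≉ (0<ι 1≤q))) ⟨
          ι q′ * ι a * (ι q * ι q ⁻¹)  ≈⟨ solve 4 (λ s t u v → s :* t :* (u :* v) := u :* s :* (t :* v)) refl (ι q′) (ι a) (ι q) (ι q ⁻¹) ⟩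
          ι q * ι q′ * (ι a * ι q ⁻¹)  ∎)
        where
        0≤2 = 0≤ι 2
        exponents-≤ : a′ ℕ.* q ℕ.≤ b′ ℕ.* q ℕ.+ a ℕ.* q′
        exponents-≤ = ^-cancelʳ-≤ _ _ 1<2 (begin
          ι 2 ^ (a′ ℕ.* q)                      ≈⟨ ^-assocʳ _ a′ q ⟨
          (ι 2 ^ a′) ^ q                        ≤⟨ ^-monoˡ-≤ q (^-nonNegative a′ 0≤2) 2^a′≤ ⟩
          (ι 2 ^ b′ * z ^ q′) ^ q               ≈⟨ ^-distrib-* _ _ q ⟩
          (ι 2 ^ b′) ^ q * (z ^ q′) ^ q         ≈⟨ *-cong (^-assocʳ _ b′ q) (^-assocʳ _ q′ q) ⟩
          ι 2 ^ (b′ ℕ.* q) * z ^ (q′ ℕ.* q)     ≡⟨ ≡.cong (λ e → ι 2 ^ (b′ ℕ.* q) * z ^ e) (ℕ.*-comm q′ q) ⟩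
          ι 2 ^ (b′ ℕ.* q) * z ^ (q ℕ.* q′)     ≈⟨ *-congˡ (^-assocʳ _ q q′) ⟨
          ι 2 ^ (b′ ℕ.* q) * (z ^ q) ^ q′       ≤⟨ *-monoˡ-≤ (^-nonNegative (b′ ℕ.* q) 0≤2) (^-monoˡ-≤ q′ (^-nonNegative q (≤-trans 0≤1 1≤z)) z^q≤2^a) ⟩
          ι 2 ^ (b′ ℕ.* q) * (ι 2 ^ a) ^ q′     ≈⟨ *-congˡ (^-assocʳ _ a q′) ⟩
          ι 2 ^ (b′ ℕ.* q) * ι 2 ^ (a ℕ.* q′)   ≈⟨ ^-homo-* _ (b′ ℕ.* q) (a ℕ.* q′) ⟨
          ι 2 ^ (b′ ℕ.* q ℕ.+ a ℕ.* q′)         ∎)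
        qa′≤ : ι q * ι a′ ≤ ι q′ * ι a + ι q * ι b′
        qa′≤ = begin
          ι q * ι a′                    ≈⟨ *-comm _ _ ⟩
          ι a′ * ι q                    ≈⟨ ι-homo-* a′ q ⟨
          ι (a′ ℕ.* q)                  ≤⟨ ι-mono-≤ exponents-≤ ⟩
          ι (b′ ℕ.* q ℕ.+ a ℕ.* q′)     ≈⟨ ι-homo-+ (b′ ℕ.* q) _ ⟩
          ι (b′ ℕ.* q) + ι (a ℕ.* q′)   ≈⟨ +-cong (ι-homo-* b′ q) (ι-homo-* a q′) ⟩
          ι b′ * ι q + ι a * ι q′       ≈⟨ solve 4 (λ s t u v → s :* t :+ u :* v := v :* u :+ t :* s) refl (ι b′) (ι q) (ι a) (ι q′) ⟩
          ι q′ * ι a + ι q * ι b′       ∎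

      0-exponent : Exponents 0#
      0-exponent = 0 , 0 , 1 , ℕ.≤-refl , trans (zeroʳ _) (sym (-‿inverseʳ _)) , 1≤* ≤-refl (1≤^ 1 1≤z)

      exponents-bounded : ∃[ u ] UpperBound Exponents u
      exponents-bounded with m , z≤2^m , _ ← ⌈log⌉ 1<2 z =
        ι m * ι 1 ⁻¹ , exponent-bound m 1 ℕ.≤-refl (≤-trans (≤-reflexive (*-identityʳ z)) z≤2^m)

    -- Together with `log-lower`, this reduces estimates of `log z` to comparisons between powers of
    -- z and powers of 2.
    log-upper : ∀ a q → 1 ℕ.≤ q → z ^ q ≤ ι 2 ^ a → ι q * log z ≤ ι a
    log-upper a q 1≤q z^q≤2^a = begin
      ι q * log z           ≤⟨ *-monoˡ-≤ (0≤ι q) (sup-least Exponents (0# , 0-exponent) (exponent-bound a q 1≤q z^q≤2^a)) ⟩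
      ι q * (ι a * ι q ⁻¹)  ≈⟨ *-comm _ _ ⟩
      ι a * ι q ⁻¹ * ι q    ≈⟨ x*y⁻¹*y≈x (0<ι 1≤q) ⟩
      ι a                   ∎

    log-lower : ∀ a b q → 1 ℕ.≤ q → ι 2 ^ a ≤ ι 2 ^ b * z ^ q → ι a ≤ ι q * log z + ι b
    log-lower a b q 1≤q 2^a≤ = x-y≤z⇒x≤z+y (begin
      ι a - ι b                     ≈⟨ qr≈a-b ⟨
      ι q * ((ι a - ι b) * ι q ⁻¹)  ≤⟨ *-monoˡ-≤ (0≤ι q) (sup-upper Exponents (0# , 0-exponent) exponents-bounded (a , b , q , 1≤q , qr≈a-b , 2^a≤)) ⟩
      ι q * log z                   ∎)
      where
      qr≈a-b : ι q * ((ι a - ι b) * ι q ⁻¹) ≈ ι a - ι b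
      qr≈a-b = trans (*-comm _ _) (x*y⁻¹*y≈x (0<ι 1≤q))

    0≤log : 0# ≤ log z
    0≤log = sup-upper Exponents (0# , 0-exponent) exponents-bounded 0-exponent

    log-mono-≤ : ∀ {w} → 1# ≤ w → w ≤ z → log w ≤ log z
    log-mono-≤ {w} 1≤w w≤z = sup-least _ (0# , 0 , 0 , 1 , ℕ.≤-refl , trans (zeroʳ _) (sym (-‿inverseʳ _)) , 1≤* ≤-refl (1≤^ 1 1≤w))
      λ (a , b , q , 1≤q , qr≈ , 2^a≤) → sup-upper Exponents (0# , 0-exponent) exponents-bounded
        (a , b , q , 1≤q , qr≈ , ≤-trans 2^a≤ (*-monoˡ-≤ (^-nonNegative b (0≤ι 2)) (^-monoˡ-≤ q (≤-trans 0≤1 1≤w) w≤z)))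

    -- Here a is q log z rounded up. The rounding costs at most a factor 2 in z^q, hence at most 1
    -- in q log z.
    log-approx : ∀ q → 1 ℕ.≤ q → ∃[ a ] (z ^ q ≤ ι 2 ^ a × ι 2 ^ a ≤ ι 2 * z ^ q) × ι q * log z ≤ ι a × ι a ≤ ι q * log z + 1#
    log-approx q 1≤q = a , (lower , upper) , log-upper a q 1≤q lower , (begin
      ι a                ≤⟨ log-lower a 1 q 1≤q (≤-trans upper (≤-reflexive (*-congʳ (sym (*-identityʳ _))))) ⟩
      ι q * log z + ι 1  ≈⟨ +-congˡ (+-identityʳ 1#) ⟩
      ι q * log z + 1#   ∎)
      where
      a = proj₁ (⌈log⌉ 1<2 (z ^ q))
      lower = proj₁ (proj₂ (⌈log⌉ 1<2 (z ^ q)))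
      upper = y^⌈log⌉≤y*z 1<2 (1≤^ q 1≤z)

  -- If y < x, the multiples of x - y eventually reach c + 1, although they are all bounded by c.
  bounded-multiples⇒≤ : ∀ {x y} c → (∀ q → 1 ℕ.≤ q → ι q * x ≤ ι q * y + ι c) → x ≤ y
  bounded-multiples⇒≤ {x} {y} c bounded with x ≤? y
  ... | yes x≤y = x≤y
  ... | no  x≰y = contradiction (let n , 1+c≤n[x-y] = archimedean-* 0<x-y (ι (suc c)) in begin
      1# + ι c                       ≤⟨ 1+c≤n[x-y] ⟩
      -- The Archimedean n may be 0, whereas the bound is available for positive multipliers.
      ι n * (x - y)                  ≤⟨ *-monoʳ-≤ (proj₁ 0<x-y) (ι-mono-≤ (ℕ.n≤1+n n)) ⟩
      ι (suc n) * (x - y)            ≈⟨ x[y-z]≈xy-xz _ _ _ ⟩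
      ι (suc n) * x - ι (suc n) * y  ≤⟨ x≤z+y⇒x-y≤z (≤-trans (bounded (suc n) (s≤s z≤n)) (≤-reflexive (+-comm _ _))) ⟩
      ι c                            ∎)
      (<⇒≱ (x<1+x (ι c)))
    where
    0<x-y : 0# < x - y
    0<x-y = ≰⇒> λ x-y≤0 → x≰y (≤-trans (x-y≤z⇒x≤z+y x-y≤0) (≤-reflexive (+-identityˡ y)))

  module _ {x y} (1≤x : 1# ≤ x) (1≤y : 1# ≤ y) where

    private
      0≤x = ≤-trans 0≤1 1≤x
      0≤y = ≤-trans 0≤1 1≤y

    -- For every q, rounding q log x and q log y to integers costs at most 2, which vanishes after division by q.
    log-*-≤ : log (x * y) ≤ log x + log y
    log-*-≤ = bounded-multiples⇒≤ 2 λ q 1≤q →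
      let a , (x^q≤2^a , _) , _ , a≤ = log-approx 1≤x q 1≤q
          b , (y^q≤2^b , _) , _ , b≤ = log-approx 1≤y q 1≤q
      in begin
        ι q * log (x * y)                      ≤⟨ log-upper (1≤* 1≤x 1≤y) (a ℕ.+ b) q 1≤q (begin
          (x * y) ^ q       ≈⟨ ^-distrib-* x y q ⟩
          x ^ q * y ^ q     ≤⟨ *-mono-≤ (^-nonNegative q 0≤x) (^-nonNegative b (0≤ι 2)) x^q≤2^a y^q≤2^b ⟩
          ι 2 ^ a * ι 2 ^ b ≈⟨ ^-homo-* _ a b ⟨
          ι 2 ^ (a ℕ.+ b)   ∎) ⟩
        ι (a ℕ.+ b)                            ≈⟨ ι-homo-+ a b ⟩
        ι a + ι b                              ≤⟨ +-mono-≤ a≤ b≤ ⟩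
        ι q * log x + 1# + (ι q * log y + 1#)  ≈⟨ solve 3 (λ q s t → q :* s :+ con 1 :+ (q :* t :+ con 1) := q :* (s :+ t) :+ (con 1 :+ (con 1 :+ con 0))) refl (ι q) (log x) (log y) ⟩
        ι q * (log x + log y) + ι 2            ∎

    log-*-≥ : log x + log y ≤ log (x * y)
    log-*-≥ = bounded-multiples⇒≤ 2 λ q 1≤q →
      let a , (_ , 2^a≤) , ≤a , _ = log-approx 1≤x q 1≤q
          b , (_ , 2^b≤) , ≤b , _ = log-approx 1≤y q 1≤q
      in begin
        ι q * (log x + log y)         ≈⟨ distribˡ _ _ _ ⟩
        ι q * log x + ι q * log y     ≤⟨ +-mono-≤ ≤a ≤b ⟩
        ι a + ι b                     ≈⟨ ι-homo-+ a b ⟨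
        -- Each of the two roundings up contributes a factor 2; together they are the 2^2 that
        -- `log-lower` turns into the error 2.
        ι (a ℕ.+ b)                   ≤⟨ log-lower (1≤* 1≤x 1≤y) (a ℕ.+ b) 2 q 1≤q (begin
          ι 2 ^ (a ℕ.+ b)                   ≈⟨ ^-homo-* _ a b ⟩
          ι 2 ^ a * ι 2 ^ b                 ≤⟨ *-mono-≤ (^-nonNegative a (0≤ι 2)) (*-nonNegative (0≤ι 2) (^-nonNegative q 0≤y)) 2^a≤ 2^b≤ ⟩
          ι 2 * x ^ q * (ι 2 * y ^ q)       ≈⟨ solve 3 (λ t u v → t :* u :* (t :* v) := t :* (t :* con 1) :* (u :* v)) refl (ι 2) (x ^ q) (y ^ q) ⟩
          ι 2 ^ 2 * (x ^ q * y ^ q)         ≈⟨ *-congˡ (^-distrib-* x y q) ⟨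
          ι 2 ^ 2 * (x * y) ^ q             ∎) ⟩
        ι q * log (x * y) + ι 2       ∎

  log-1 : log 1# ≤ 0#
  log-1 = begin
    log 1#         ≈⟨ trans (*-congʳ (+-identityʳ 1#)) (*-identityˡ _) ⟨
    ι 1 * log 1#   ≤⟨ log-upper ≤-refl 0 1 ℕ.≤-refl (≤-reflexive (*-identityˡ 1#)) ⟩
    0#             ∎

  log-^-≤ : ∀ {x} n → 1# ≤ x → log (x ^ n) ≤ ι n * log x
  log-^-≤ {x} 0       1≤x = ≤-trans log-1 (≤-reflexive (sym (zeroˡ _)))
  log-^-≤ {x} (suc n) 1≤x = begin
    log (x * x ^ n)       ≤⟨ log-*-≤ 1≤x (1≤^ n 1≤x) ⟩
    log x + log (x ^ n)   ≤⟨ +-monoʳ-≤ _ (log-^-≤ n 1≤x) ⟩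
    log x + ι n * log x   ≈⟨ +-congʳ (*-identityˡ _) ⟨
    1# * log x + ι n * log x ≈⟨ distribʳ _ _ _ ⟨
    ι (suc n) * log x     ∎

  log-^-≥ : ∀ {x} n → 1# ≤ x → ι n * log x ≤ log (x ^ n)
  log-^-≥ {x} 0       1≤x = ≤-trans (≤-reflexive (zeroˡ _)) (0≤log ≤-refl)
  log-^-≥ {x} (suc n) 1≤x = begin
    ι (suc n) * log x     ≈⟨ distribʳ _ _ _ ⟩
    1# * log x + ι n * log x ≈⟨ +-congʳ (*-identityˡ _) ⟩
    log x + ι n * log x   ≤⟨ +-monoʳ-≤ _ (log-^-≥ n 1≤x) ⟩
    log x + log (x ^ n)   ≤⟨ log-*-≥ 1≤x (1≤^ n 1≤x) ⟩
    log (x * x ^ n)       ∎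

  2^n≤z⇒n≤log : ∀ {z} n → ι 2 ^ n ≤ z → ι n ≤ log z
  2^n≤z⇒n≤log {z} n 2^n≤z = begin
    ι n                   ≤⟨ log-lower 1≤z n 0 1 ℕ.≤-refl (≤-trans 2^n≤z (≤-reflexive (sym (trans (*-identityˡ _) (*-identityʳ _))))) ⟩
    ι 1 * log z + 0#      ≈⟨ solve 1 (λ l → (con 1 :+ con 0) :* l :+ con 0 := l) refl (log z) ⟩
    log z                 ∎
    where
    1≤z : 1# ≤ z
    1≤z = ≤-trans (1≤^ n (proj₁ 1<2)) 2^n≤z

  z≤2⇒log≤1 : ∀ {z} → 1# ≤ z → z ≤ ι 2 → log z ≤ 1#
  z≤2⇒log≤1 {z} 1≤z z≤2 = begin
    log z          ≈⟨ solve 1 (λ l → l := (con 1 :+ con 0) :* l) refl (log z) ⟩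
    ι 1 * log z    ≤⟨ log-upper 1≤z 1 1 ℕ.≤-refl (*-monoʳ-≤ 0≤1 z≤2) ⟩
    ι 1            ≈⟨ +-identityʳ 1# ⟩
    1#             ∎

  -- Some power z^q reaches 2, so q log z ≥ 1.
  0<log : ∀ {z} → 1# < z → 0# < log z
  0<log {z} 1<z with q , 2≤z^q , _ ← ⌈log⌉ 1<z (ι 2) =
    *-cancelˡ-< (0≤ι q) (begin-strict
      ι q * 0#      ≈⟨ zeroʳ _ ⟩
      0#            <⟨ 0<1 ⟩
      1#            ≈⟨ +-identityʳ 1# ⟨
      ι 1           ≤⟨ 2^n≤z⇒n≤log 1 (≤-trans (≤-reflexive (*-identityʳ _)) 2≤z^q) ⟩
      log (z ^ q)   ≤⟨ log-^-≤ q (proj₁ 1<z) ⟩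
      ι q * log z   ∎)

  -- With c ≤ r δ, every n ≥ 2^(r+1) has log n ≥ r + 1, so c ≤ r δ < (r + 1) δ ≤ δ log n. The
  -- additional 1 makes the inequality strict and log n positive.
  c/log⟶0 : ∀ c → 1 ℕ.≤ c → (λ n → ι c * log (ι n) ⁻¹) ⟶0
  c/log⟶0 c 1≤c δ 0<δ with r , c≤rδ ← archimedean-* 0<δ (ι c) = 2 ℕ.^ suc r , λ n M≤n →
    let L = log (ι n)
        1+r≤L : ι (suc r) ≤ L
        1+r≤L = 2^n≤z⇒n≤log (suc r) (≤-trans (≤-reflexive (sym (ι-homo-^ (suc r)))) (ι-mono-≤ M≤n))
        0<L : 0# < L
        0<L = <-≤-trans (0<ι {suc r} (s≤s z≤n)) 1+r≤L
    in ≤-<-trans -δ≤0 (*-pos (0<ι 1≤c) (⁻¹-pos 0<L)) , *-cancelˡ-< (proj₁ 0<L) (begin-strict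
      L * (ι c * L ⁻¹)   ≈⟨ solve 3 (λ L c L′ → L :* (c :* L′) := c :* L′ :* L) refl L (ι c) (L ⁻¹) ⟩
      ι c * L ⁻¹ * L     ≈⟨ x*y⁻¹*y≈x 0<L ⟩
      ι c                ≤⟨ c≤rδ ⟩
      ι r * δ            <⟨ r*δ<[1+r]*δ r ⟩
      ι (suc r) * δ      ≤⟨ *-monoʳ-≤ (proj₁ 0<δ) 1+r≤L ⟩
      L * δ              ∎)
    where
    -δ≤0 : - δ ≤ 0#
    -δ≤0 = +-cancelˡ-≤ δ (begin
      δ - δ    ≈⟨ -‿inverseʳ δ ⟩
      0#       ≤⟨ proj₁ 0<δ ⟩
      δ        ≈⟨ +-identityʳ δ ⟨
      δ + 0#   ∎)
    r*δ<[1+r]*δ : ∀ r → ι r * δ < ι (suc r) * δ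
    r*δ<[1+r]*δ r = ≰⇒> λ le → <⇒≱ (x<1+x (ι r)) (*-cancelˡ-≤ 0<δ
      (≤-trans (≤-reflexive (*-comm _ _)) (≤-trans le (≤-reflexive (*-comm _ _)))))

-- Finite sums over lists.

module Summation {ℓ} (ℝ : RealField ℓ) where

  open RealField ℝ hiding (zero)
  open OrderedField ℝ
  open ≤-Reasoning

  module _ {a} {A : Set a} where

    ∑-cong-local : ∀ {f g : A → Carrier} {xs} → All (λ x → f x ≈ g x) xs → ∑ xs f ≈ ∑ xs g
    ∑-cong-local []         = refl
    ∑-cong-local (eq ∷ eqs) = +-cong eq (∑-cong-local eqs)

    ∑-cong : ∀ xs {f g : A → Carrier} → (∀ x → f x ≈ g x) → ∑ xs f ≈ ∑ xs g
    ∑-cong xs f≈g = ∑-cong-local (All.universal f≈g xs)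

    ∑-mono-≤-local : ∀ {f g : A → Carrier} {xs} → All (λ x → f x ≤ g x) xs → ∑ xs f ≤ ∑ xs g
    ∑-mono-≤-local []         = ≤-refl
    ∑-mono-≤-local (le ∷ les) = +-mono-≤ le (∑-mono-≤-local les)

    ∑-mono-≤ : ∀ xs {f g : A → Carrier} → (∀ x → f x ≤ g x) → ∑ xs f ≤ ∑ xs g
    ∑-mono-≤ xs f≤g = ∑-mono-≤-local (All.universal f≤g xs)

    ∑-nonNegative : ∀ xs {f : A → Carrier} → (∀ x → 0# ≤ f x) → 0# ≤ ∑ xs f
    ∑-nonNegative []       0≤f = ≤-refl
    ∑-nonNegative (x ∷ xs) 0≤f = +-nonNegative (0≤f x) (∑-nonNegative xs 0≤f)

    ∑-++ : ∀ (f : A → Carrier) xs ys → ∑ (xs ++ ys) f ≈ ∑ xs f + ∑ ys f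
    ∑-++ f []       ys = sym (+-identityˡ _)
    ∑-++ f (x ∷ xs) ys = trans (+-congˡ (∑-++ f xs ys)) (sym (+-assoc _ _ _))

    ∑-+ : ∀ (f g : A → Carrier) xs → ∑ xs (λ x → f x + g x) ≈ ∑ xs f + ∑ xs g
    ∑-+ f g []       = sym (+-identityˡ _)
    ∑-+ f g (x ∷ xs) = trans (+-congˡ (∑-+ f g xs))
      (solve 4 (λ s t u v → s :+ t :+ (u :+ v) := s :+ u :+ (t :+ v)) refl (f x) (g x) (∑ xs f) (∑ xs g))

    ∑-*ˡ : ∀ c (f : A → Carrier) xs → ∑ xs (λ x → c * f x) ≈ c * ∑ xs f
    ∑-*ˡ c f []       = sym (zeroʳ c)
    ∑-*ˡ c f (x ∷ xs) = trans (+-congˡ (∑-*ˡ c f xs)) (sym (distribˡ c _ _))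

    -- For weights f, every cost g is at most v, and on Q at most v - w; the weight of Q therefore
    -- saves w times itself. The saving stands on the left to avoid subtraction. In the application
    -- f is the split distribution and Q is balance.
    ∑-filter-≤ : ∀ {q} {Q : Pred A q} (Q? : Decidable Q) (f g : A → Carrier) v w {xs} →
                 All (λ x → 0# ≤ f x × g x ≤ v × (Q x → g x + w ≤ v)) xs →
                 (∑[ x ∈ xs ] (f x * g x)) + w * ∑ (filter Q? xs) f ≤ v * ∑ xs f
    ∑-filter-≤ Q? f g v w [] = ≤-reflexive (trans (+-identityˡ _) (trans (zeroʳ w) (sym (zeroʳ v))))
    ∑-filter-≤ Q? f g v w {x ∷ xs} ((0≤f , g≤v , g+w≤v) ∷ hs) with Q? x
    ... | yes Qx = begin
      f x * g x + S + w * (f x + F)        ≈⟨ solve 5 (λ f g s w t → f :* g :+ s :+ w :* (f :+ t) := f :* (g :+ w) :+ (s :+ w :* t)) refl (f x) (g x) S w F ⟩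
      f x * (g x + w) + (S + w * F)        ≤⟨ +-mono-≤ (*-monoˡ-≤ 0≤f (g+w≤v Qx)) (∑-filter-≤ Q? f g v w hs) ⟩
      f x * v + v * ∑ xs f                 ≈⟨ solve 3 (λ f v s → f :* v :+ v :* s := v :* (f :+ s)) refl (f x) v (∑ xs f) ⟩
      v * (f x + ∑ xs f)                   ∎
      where
      S = ∑[ x ∈ xs ] (f x * g x)
      F = ∑ (filter Q? xs) f
    ... | no _ = begin
      f x * g x + S + w * F                ≈⟨ +-assoc _ _ _ ⟩
      f x * g x + (S + w * F)              ≤⟨ +-mono-≤ (*-monoˡ-≤ 0≤f g≤v) (∑-filter-≤ Q? f g v w hs) ⟩
      f x * v + v * ∑ xs f                 ≈⟨ solve 3 (λ f v s → f :* v :+ v :* s := v :* (f :+ s)) refl (f x) v (∑ xs f) ⟩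
      v * (f x + ∑ xs f)                   ∎
      where
      S = ∑[ x ∈ xs ] (f x * g x)
      F = ∑ (filter Q? xs) f

  ∑-map : ∀ {a b} {A : Set a} {B : Set b} (f : B → Carrier) (h : A → B) xs → ∑ (map h xs) f ≈ ∑ xs (f ∘ h)
  ∑-map f h []       = refl
  ∑-map f h (x ∷ xs) = +-congˡ (∑-map f h xs)

  ∑-concatMap : ∀ {a b} {A : Set a} {B : Set b} (f : B → Carrier) (h : A → List B) xs →
                ∑ (concatMap h xs) f ≈ ∑[ x ∈ xs ] ∑ (h x) f
  ∑-concatMap f h []       = refl
  ∑-concatMap f h (x ∷ xs) = trans (∑-++ f (h x) _) (+-congˡ (∑-concatMap f h xs))

  ∑-cartesianProductWith : ∀ {a b c} {A : Set a} {B : Set b} {C : Set c} (f : C → Carrier) (h : A → B → C) xs ys →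
                           ∑ (cartesianProductWith h xs ys) f ≈ ∑[ x ∈ xs ] (∑[ y ∈ ys ] f (h x y))
  ∑-cartesianProductWith f h []       ys = refl
  ∑-cartesianProductWith f h (x ∷ xs) ys =
    trans (∑-++ f (map (h x) ys) _) (+-cong (∑-map f (h x) ys) (∑-cartesianProductWith f h xs ys))

-- Sizes of splits and of enumerated trees.

[1‥-1]-bounds : ∀ n → All (λ i → 1 ℕ.≤ i × i ℕ.< n) [1‥ n -1]
[1‥-1]-bounds 0       = []
[1‥-1]-bounds (suc n) = All.applyUpTo⁺₁ suc n λ i<n → s≤s z≤n , s≤s i<n

1≤∣_∣ : ∀ t → 1 ℕ.≤ ∣ t ∣
1≤∣ leaf _ ∣     = ℕ.≤-refl
1≤∣ node l _ r ∣ = ℕ.≤-trans 1≤∣ l ∣ (ℕ.m≤m+n _ _)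

-- Makes the factor σ at the root constant on the pairs of subtrees with given sizes, whatever the
-- depth bound.
treesOfSize-size : ∀ d n → All (λ t → ∣ t ∣ ≡ n) (treesOfSize d n)
treesOfSize-size d       0               = []
treesOfSize-size d       1               = ≡.refl ∷ []
treesOfSize-size ℕ.zero  (suc (suc _))   = []
treesOfSize-size (suc d) n@(suc (suc _)) = All.concat⁺ (All.map⁺ (All.map
  (λ {i} (_ , i<n) → All.cartesianProductWith⁺ (≡.setoid _) (≡.setoid _) _ (treesOfSize d i) (treesOfSize d (n ∸ i))
    λ l∈ r∈ → ≡.trans (≡.cong₂ ℕ._+_ (All.lookup (treesOfSize-size d i) l∈) (All.lookup (treesOfSize-size d (n ∸ i)) r∈))
                      (ℕ.m+[n∸m]≡n (ℕ.<⇒≤ i<n)))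
  ([1‥-1]-bounds n)))

module TreeHeight {ℓ} (ℝ : RealField ℓ) where

  open RealField ℝ hiding (zero)
  open TreeSource ℝ
  open OrderedField ℝ
  open Logarithm ℝ
  open Summation ℝ
  open ≤-Reasoning

  -- Expectations over random trees and their recursion at the root.

  module LeafCentric {σ : ℕ → ℕ → Carrier} (leafCentric : ℒ σ) where

    open ℒ leafCentric

    σ-nonNegative : ∀ {i k} → 1 ℕ.≤ i → i ℕ.< k → 0# ≤ σ i (k ∸ i)
    σ-nonNegative 1≤i i<k = proj₁ (in[0,1] _ _ 1≤i (ℕ.m<n⇒0<n∸m i<k))

    P-nonNegative : ∀ t → 0# ≤ P σ t
    P-nonNegative (leaf _)     = 0≤1
    P-nonNegative (node l _ r) =
      *-nonNegative (*-nonNegative (proj₁ (in[0,1] _ _ 1≤∣ l ∣ 1≤∣ r ∣)) (P-nonNegative l)) (P-nonNegative r)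

    -- treesOfSize d n lacks the trees that are too high for the depth bound d, so 𝔼 d n has total mass at most,
    -- but not always equal to, 1.
    𝔼 : ℕ → ℕ → (𝒯 → Carrier) → Carrier
    𝔼 d n u = ∑[ t ∈ treesOfSize d n ] (P σ t * u t)

    𝔼-mono-≤ : ∀ d n {u v} → (∀ t → u t ≤ v t) → 𝔼 d n u ≤ 𝔼 d n v
    𝔼-mono-≤ d n u≤v = ∑-mono-≤ (treesOfSize d n) λ t → *-monoˡ-≤ (P-nonNegative t) (u≤v t)

    𝔼-nonNegative : ∀ d n {u} → (∀ t → 0# ≤ u t) → 0# ≤ 𝔼 d n u
    𝔼-nonNegative d n 0≤u = ∑-nonNegative (treesOfSize d n) λ t → *-nonNegative (P-nonNegative t) (0≤u t)

    𝔼-*ˡ : ∀ d n c u → 𝔼 d n (λ t → c * u t) ≈ c * 𝔼 d n u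
    𝔼-*ˡ d n c u = trans
      (∑-cong (treesOfSize d n) λ t → solve 3 (λ p c u → p :* (c :* u) := c :* (p :* u)) refl (P σ t) c (u t))
      (∑-*ˡ c _ (treesOfSize d n))

    𝔼-+ : ∀ d n u v → 𝔼 d n (λ t → u t + v t) ≈ 𝔼 d n u + 𝔼 d n v
    𝔼-+ d n u v = trans
      (∑-cong (treesOfSize d n) λ t → distribˡ _ _ _)
      (∑-+ _ _ (treesOfSize d n))

    𝔼-split : ℕ → ℕ → ℕ → (𝒯 → Carrier) → Carrier
    𝔼-split d i j u = ∑[ l ∈ treesOfSize d i ] (∑[ r ∈ treesOfSize d j ] (P σ (node l tt r) * u (node l tt r)))

    𝔼-root : ∀ d m u → 𝔼 (suc d) (2 ℕ.+ m) u ≈ ∑[ i ∈ [1‥ 2 ℕ.+ m -1] ] 𝔼-split d i (2 ℕ.+ m ∸ i) u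
    𝔼-root d m u = trans
      (∑-concatMap (λ t → P σ t * u t) (λ i → cartesianProductWith (λ l r → node l tt r) (treesOfSize d i) (treesOfSize d (2 ℕ.+ m ∸ i))) [1‥ 2 ℕ.+ m -1])
      (∑-cong [1‥ 2 ℕ.+ m -1] λ i → ∑-cartesianProductWith (λ t → P σ t * u t) (λ l r → node l tt r) (treesOfSize d i) (treesOfSize d (2 ℕ.+ m ∸ i)))

    -- Once the sizes i and j are fixed, the root factor is the constant σ(i,j) and `P` is a product
    -- over the two subtrees, so the double sum factors.
    independence : ∀ d i j (u v : 𝒯 → Carrier) →
      ∑[ l ∈ treesOfSize d i ] (∑[ r ∈ treesOfSize d j ] (P σ (node l tt r) * (u l * v r))) ≈ σ i j * (𝔼 d i u * 𝔼 d j v)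
    independence d i j u v = begin-equality
      ∑[ l ∈ treesOfSize d i ] (∑[ r ∈ treesOfSize d j ] (σ ∣ l ∣ ∣ r ∣ * P σ l * P σ r * (u l * v r)))
        ≈⟨ ∑-cong-local (All.map (λ {l} ∣l∣≡i → trans
             (∑-cong-local (All.map (λ {r} ∣r∣≡j → rearrange l r ∣l∣≡i ∣r∣≡j) (treesOfSize-size d j)))
             (∑-*ˡ _ _ (treesOfSize d j))) (treesOfSize-size d i)) ⟩
      ∑[ l ∈ treesOfSize d i ] (σ i j * (P σ l * u l) * 𝔼 d j v)
        ≈⟨ ∑-cong (treesOfSize d i) (λ l → solve 3 (λ s a e → s :* a :* e := s :* e :* a) refl (σ i j) (P σ l * u l) (𝔼 d j v)) ⟩
      ∑[ l ∈ treesOfSize d i ] (σ i j * 𝔼 d j v * (P σ l * u l))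
        ≈⟨ ∑-*ˡ _ _ (treesOfSize d i) ⟩
      σ i j * 𝔼 d j v * 𝔼 d i u
        ≈⟨ solve 3 (λ s e f → s :* e :* f := s :* (f :* e)) refl (σ i j) (𝔼 d j v) (𝔼 d i u) ⟩
      σ i j * (𝔼 d i u * 𝔼 d j v) ∎
      where
      rearrange : ∀ l r → ∣ l ∣ ≡ i → ∣ r ∣ ≡ j →
                  σ ∣ l ∣ ∣ r ∣ * P σ l * P σ r * (u l * v r) ≈ σ i j * (P σ l * u l) * (P σ r * v r)
      rearrange l r ≡.refl ≡.refl = solve 5 (λ s p q a b → s :* p :* q :* (a :* b) := s :* (p :* a) :* (q :* b)) refl
        (σ i j) (P σ l) (P σ r) (u l) (v r)

    mass : ℕ → ℕ → Carrier
    mass d n = 𝔼 d n (λ _ → 1#)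

    -- By induction on the depth bound, each split contributes at most its own probability, and
    -- these sum to 1. Where the depth bound runs out, the list of trees is empty.
    mass≤1 : ∀ d n → mass d n ≤ 1#
    mass≤1 d       0             = 0≤1
    mass≤1 d       1             = ≤-reflexive (trans (+-identityʳ _) (*-identityʳ 1#))
    mass≤1 ℕ.zero  (suc (suc m)) = 0≤1
    mass≤1 (suc d) (suc (suc m)) = begin
      mass (suc d) n                                                          ≈⟨ 𝔼-root d m _ ⟩
      ∑[ i ∈ [1‥ n -1] ] 𝔼-split d i (n ∸ i) (λ _ → 1#)                       ≤⟨ ∑-mono-≤-local (All.map (λ {i} (1≤i , i<n) → bound i 1≤i i<n) ([1‥-1]-bounds n)) ⟩
      ∑[ i ∈ [1‥ n -1] ] σ i (n ∸ i)                                          ≈⟨ sum≈1 n (s≤s (s≤s z≤n)) ⟩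
      1#                                                                      ∎
      where
      n = 2 ℕ.+ m
      bound : ∀ i → 1 ℕ.≤ i → i ℕ.< n → 𝔼-split d i (n ∸ i) (λ _ → 1#) ≤ σ i (n ∸ i)
      bound i 1≤i i<n = begin
        -- Writing 1 as a product of a function of l and a function of r makes `independence`
        -- applicable.
        𝔼-split d i (n ∸ i) (λ _ → 1#)             ≈⟨ ∑-cong (treesOfSize d i) (λ l → ∑-cong (treesOfSize d (n ∸ i)) λ r → *-congˡ (sym (*-identityˡ 1#))) ⟩
        𝔼-split d i (n ∸ i) (λ _ → 1# * 1#)        ≈⟨ independence d i (n ∸ i) _ _ ⟩
        σ i (n ∸ i) * (mass d i * mass d (n ∸ i))  ≤⟨ *-monoˡ-≤ (σ-nonNegative 1≤i i<n) (*-mono-≤ (𝔼-nonNegative d i (λ _ → 0≤1)) 0≤1 (mass≤1 d i) (mass≤1 d (n ∸ i))) ⟩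
        σ i (n ∸ i) * (1# * 1#)                    ≈⟨ trans (*-congˡ (*-identityˡ 1#)) (*-identityʳ _) ⟩
        σ i (n ∸ i)                                ∎

    -- x ^ max(a, b) ≤ x ^ a + x ^ b turns the height generating function into a sum over the two subtrees.
    𝔼-split-x^height : ∀ {x} → 1# ≤ x → ∀ d i k → 1 ℕ.≤ i → i ℕ.< k →
      𝔼-split d i (k ∸ i) (λ t → x ^ height t) ≤
      σ i (k ∸ i) * (x * (𝔼 d i (λ t → x ^ height t) + 𝔼 d (k ∸ i) (λ t → x ^ height t)))
    𝔼-split-x^height {x} 1≤x d i k 1≤i i<k = begin
      𝔼-split d i j X
        ≤⟨ ∑-mono-≤ (treesOfSize d i) (λ l → ∑-mono-≤ (treesOfSize d j) (node-≤ l)) ⟩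
      -- Each summand depends on one subtree only; the factor `1#` stands for the other one, which
      -- then contributes its mass, at most 1.
      ∑[ l ∈ treesOfSize d i ] (∑[ r ∈ treesOfSize d j ] (Q l r * (x * X l * 1#) + Q l r * (1# * (x * X r))))
        ≈⟨ ∑-cong (treesOfSize d i) (λ l → ∑-+ _ _ (treesOfSize d j)) ⟩
      ∑[ l ∈ treesOfSize d i ] ((∑[ r ∈ treesOfSize d j ] (Q l r * (x * X l * 1#))) + (∑[ r ∈ treesOfSize d j ] (Q l r * (1# * (x * X r)))))
        ≈⟨ ∑-+ _ _ (treesOfSize d i) ⟩
      (∑[ l ∈ treesOfSize d i ] (∑[ r ∈ treesOfSize d j ] (Q l r * (x * X l * 1#)))) + (∑[ l ∈ treesOfSize d i ] (∑[ r ∈ treesOfSize d j ] (Q l r * (1# * (x * X r)))))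
        ≈⟨ +-cong (independence d i j _ _) (independence d i j _ _) ⟩
      σ i j * (𝔼 d i (λ t → x * X t) * mass d j) + σ i j * (mass d i * 𝔼 d j (λ t → x * X t))
        ≈⟨ +-cong (*-congˡ (*-congʳ (𝔼-*ˡ d i x X))) (*-congˡ (*-congˡ (𝔼-*ˡ d j x X))) ⟩
      σ i j * (x * 𝔼 d i X * mass d j) + σ i j * (mass d i * (x * 𝔼 d j X))
        ≈⟨ solve 6 (λ s x e m f n → s :* (x :* e :* m) :+ s :* (n :* (x :* f)) := s :* (x :* (e :* m :+ f :* n))) refl
             (σ i j) x (𝔼 d i X) (mass d j) (𝔼 d j X) (mass d i) ⟩
      σ i j * (x * (𝔼 d i X * mass d j + 𝔼 d j X * mass d i))
        ≤⟨ *-monoˡ-≤ (σ-nonNegative 1≤i i<k) (*-monoˡ-≤ 0≤x (+-mono-≤ (times-mass i j) (times-mass j i))) ⟩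
      σ i j * (x * (𝔼 d i X + 𝔼 d j X)) ∎
      where
      j = k ∸ i
      0≤x = ≤-trans 0≤1 1≤x
      X : 𝒯 → Carrier
      X t = x ^ height t
      0≤X : ∀ t → 0# ≤ X t
      0≤X t = ^-nonNegative (height t) 0≤x
      Q : 𝒯 → 𝒯 → Carrier
      Q l r = P σ (node l tt r)
      x^⊔≤ : ∀ a b → x ^ (a ℕ.⊔ b) ≤ x ^ a + x ^ b
      x^⊔≤ a b with ℕ.≤-total a b
      ... | inj₁ a≤b = ≤-trans (^-monoʳ-≤ 1≤x (ℕ.≤-reflexive (ℕ.m≤n⇒m⊔n≡n a≤b))) (x≤y+x (^-nonNegative a 0≤x))
      ... | inj₂ b≤a = ≤-trans (^-monoʳ-≤ 1≤x (ℕ.≤-reflexive (ℕ.m≥n⇒m⊔n≡m b≤a))) (x≤x+y (^-nonNegative b 0≤x))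
      node-≤ : ∀ l r → Q l r * X (node l tt r) ≤ Q l r * (x * X l * 1#) + Q l r * (1# * (x * X r))
      node-≤ l r = begin
        Q l r * (x * x ^ (height l ℕ.⊔ height r)) ≤⟨ *-monoˡ-≤ (P-nonNegative (node l tt r)) (*-monoˡ-≤ 0≤x (x^⊔≤ (height l) (height r))) ⟩
        Q l r * (x * (X l + X r))                 ≈⟨ solve 4 (λ q x a b → q :* (x :* (a :+ b)) := q :* (x :* a :* con 1) :+ q :* (con 1 :* (x :* b))) refl (Q l r) x (X l) (X r) ⟩
        Q l r * (x * X l * 1#) + Q l r * (1# * (x * X r)) ∎
      times-mass : ∀ a b → 𝔼 d a X * mass d b ≤ 𝔼 d a X
      times-mass a b = ≤-trans (*-monoˡ-≤ (𝔼-nonNegative d a 0≤X) (mass≤1 d b)) (≤-reflexive (*-identityʳ _))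

  -- The logarithmic scale with base 1/(1-γ), and balanced splits.

  module BalanceParameter {γ : Carrier} (0<γ : 0# < γ) (γ<½ : γ < 1# / ι 2) where

    y : Carrier
    y = 1# / (1# - γ)

    private
      ½ : Carrier
      ½ = 1# / ι 2

      ½*2≈1 : ½ * ι 2 ≈ 1#
      ½*2≈1 = x*y⁻¹*y≈x (0<ι {2} (s≤s z≤n))

      ½≤1-γ : ½ ≤ 1# - γ
      ½≤1-γ = +-cancelˡ-≤ γ (begin
        γ + ½          ≤⟨ +-monoˡ-≤ ½ (proj₁ γ<½) ⟩
        ½ + ½          ≈⟨ solve 1 (λ h → h :+ h := h :* (con 1 :+ (con 1 :+ con 0))) refl ½ ⟩
        ½ * ι 2        ≈⟨ ½*2≈1 ⟩
        1#             ≈⟨ x-y+y≈x 1# γ ⟨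
        1# - γ + γ     ≈⟨ +-comm _ _ ⟩
        γ + (1# - γ)   ∎)

    0<1-γ : 0# < 1# - γ
    0<1-γ = <-≤-trans (≤-<-trans (proj₁ 0<γ) γ<½) ½≤1-γ

    1-γ<1 : 1# - γ < 1#
    1-γ<1 = ≰⇒> λ 1≤1-γ → <⇒≱ 0<γ (+-cancelˡ-≤ (1# - γ) (begin
      1# - γ + γ   ≈⟨ x-y+y≈x 1# γ ⟩
      1#           ≤⟨ 1≤1-γ ⟩
      1# - γ       ≈⟨ +-identityʳ _ ⟨
      1# - γ + 0#  ∎))

    [1-γ]*y≈1 : (1# - γ) * y ≈ 1#
    [1-γ]*y≈1 = trans (*-comm _ _) (x*y⁻¹*y≈x 0<1-γ)

    1<y : 1# < y
    1<y = *-cancelˡ-< (proj₁ 0<1-γ) (begin-strict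
      (1# - γ) * 1#  ≈⟨ *-identityʳ _ ⟩
      1# - γ         <⟨ 1-γ<1 ⟩
      1#             ≈⟨ [1-γ]*y≈1 ⟨
      (1# - γ) * y   ∎)

    -- Holds because 1 - γ ≥ 1/2. It yields log y ≤ 1, by which the final estimate absorbs the term
    -- log n.
    y≤2 : y ≤ ι 2
    y≤2 = *-cancelˡ-≤ 0<1-γ (begin
      (1# - γ) * y    ≈⟨ [1-γ]*y≈1 ⟩
      1#              ≈⟨ ½*2≈1 ⟨
      ½ * ι 2         ≤⟨ *-monoʳ-≤ (0≤ι 2) ½≤1-γ ⟩
      (1# - γ) * ι 2  ∎)

    level : ℕ → ℕ
    level k = proj₁ (⌈log⌉ 1<y (ι k))

    ι≤y^level : ∀ k → ι k ≤ y ^ level k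
    ι≤y^level k = proj₁ (proj₂ (⌈log⌉ 1<y (ι k)))

    level-least : ∀ k {e} → ι k ≤ y ^ e → level k ℕ.≤ e
    level-least k = proj₂ (proj₂ (⌈log⌉ 1<y (ι k))) _

    level-mono-≤ : ∀ {k n} → k ℕ.≤ n → level k ℕ.≤ level n
    level-mono-≤ {k} {n} k≤n = level-least k (≤-trans (ι-mono-≤ k≤n) (ι≤y^level n))

    -- The factor 1 - γ cancels one factor y in the bound n ≤ y^(level n).
    level-drop : ∀ {k n} → 2 ℕ.≤ n → ι k ≤ (1# - γ) * ι n → level k ℕ.< level n
    level-drop {k} {n} 2≤n k≤[1-γ]n = drop (level n) (ι≤y^level n)
      where
      drop : ∀ e → ι n ≤ y ^ e → level k ℕ.< e
      -- Level 0 would mean n ≤ 1, so there is always a factor y to cancel.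
      drop 0       n≤1     = contradiction (≤-trans (ι-mono-≤ 2≤n) n≤1) (<⇒≱ 1<2)
      drop (suc e) n≤y^1+e = s≤s (level-least k (begin
        ι k                       ≤⟨ k≤[1-γ]n ⟩
        (1# - γ) * ι n            ≤⟨ *-monoˡ-≤ (proj₁ 0<1-γ) n≤y^1+e ⟩
        (1# - γ) * (y * y ^ e)    ≈⟨ *-assoc _ _ _ ⟨
        (1# - γ) * y * y ^ e      ≈⟨ trans (*-congʳ [1-γ]*y≈1) (*-identityˡ _) ⟩
        y ^ e                     ∎))

    -- Rounding up to the integer level costs at most one factor y, which is the summand log y.
    level*log≤ : ∀ {n} → 1 ℕ.≤ n → ι (level n) * log y ≤ log y + log (ι n)
    level*log≤ {n} 1≤n = begin
      ι (level n) * log y  ≤⟨ log-^-≥ (level n) (proj₁ 1<y) ⟩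
      log (y ^ level n)    ≤⟨ log-mono-≤ (1≤* (proj₁ 1<y) (1≤ι 1≤n)) (1≤^ (level n) (proj₁ 1<y)) (y^⌈log⌉≤y*z 1<y (1≤ι 1≤n)) ⟩
      log (y * ι n)        ≤⟨ log-*-≤ (proj₁ 1<y) (1≤ι 1≤n) ⟩
      log y + log (ι n)    ∎

    Balanced : ℕ → ℕ → Set ℓ
    Balanced n k = γ * ι n ≤ ι k × ι k ≤ (1# - γ) * ι n

    balanced? : ∀ n → Decidable (Balanced n)
    balanced? n k = (γ * ι n ≤? ι k) ×-dec (ι k ≤? (1# - γ) * ι n)

    -- The lower bound γ n ≤ k is an upper bound for the other part n - k, so a balanced split
    -- lowers the level of both subtrees.
    balanced-complement : ∀ {n k} → k ℕ.≤ n → Balanced n k → ι (n ∸ k) ≤ (1# - γ) * ι n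
    balanced-complement {n} {k} k≤n (γn≤k , _) = +-cancelˡ-≤ (γ * ι n) (begin
      γ * ι n + ι (n ∸ k)         ≤⟨ +-monoˡ-≤ _ γn≤k ⟩
      ι k + ι (n ∸ k)             ≈⟨ ι-homo-+ k (n ∸ k) ⟨
      ι (k ℕ.+ (n ∸ k))           ≡⟨ ≡.cong ι (ℕ.m+[n∸m]≡n k≤n) ⟩
      ι n                         ≈⟨ *-identityˡ _ ⟨
      1# * ι n                    ≈⟨ *-congʳ (x-y+y≈x 1# γ) ⟨
      (1# - γ + γ) * ι n          ≈⟨ trans (distribʳ _ _ _) (+-comm _ _) ⟩
      γ * ι n + (1# - γ) * ι n    ∎)

    -- The two sides range over 0, ..., n and 1, ..., n - 1. The endpoint 0 is rejected because γ n
    -- > 0, and n because (1 - γ) n < n.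
    balancedSplits-filter : ∀ n → 1 ℕ.≤ n → balancedSplits γ n ≡ filter (balanced? n) [1‥ n -1]
    balancedSplits-filter (suc m) _ = ≡.trans
      (List.filter-reject Q? (λ (γn≤0 , _) → <⇒≱ (*-pos 0<γ 0<n) γn≤0)) (≡.trans
      (≡.cong (filter Q?) (≡.sym (List.applyUpTo-∷ʳ suc m))) (≡.trans
      (List.filter-++ Q? (applyUpTo suc m) _) (≡.trans
      (≡.cong (filter Q? (applyUpTo suc m) ++_) (List.filter-reject Q? n-unbalanced))
      (List.++-identityʳ _))))
      where
      Q? = balanced? (suc m)
      0<n : 0# < ι (suc m)
      0<n = 0<ι {suc m} (s≤s z≤n)
      n-unbalanced : ¬ Balanced (suc m) (suc m)
      n-unbalanced (_ , n≤[1-γ]n) = <⇒≱ 1-γ<1 (*-cancelˡ-≤ 0<n (begin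
        ι (suc m) * 1#        ≈⟨ *-identityʳ _ ⟩
        ι (suc m)             ≤⟨ n≤[1-γ]n ⟩
        (1# - γ) * ι (suc m)  ≈⟨ *-comm _ _ ⟩
        ι (suc m) * (1# - γ)  ∎))

  -- The exponential moment of the height.

  module HeightBound {σ : ℕ → ℕ → Carrier} (leafCentric : ℒ σ)
                     {γ : Carrier} (0<γ : 0# < γ) (γ<½ : γ < 1# / ι 2)
                     {p : Carrier} (0<p : 0# < p) (p≤1 : p ≤ 1#) (N n₀ : ℕ)
                     -- For a fixed size `n₀` the constant p is φ(`n₀`); as φ decreases, it bounds
                     -- the balanced weight from below at all smaller sizes from `N` on.
                     (balanced : ∀ k → N ℕ.≤ k → k ℕ.≤ n₀ → p ≤ ∑[ i ∈ balancedSplits γ k ] σ i (k ∸ i)) where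

    open LeafCentric leafCentric
    open BalanceParameter 0<γ γ<½
    open ℒ leafCentric

    x : Carrier
    x = 1# + p

    β : Carrier
    β = p ⁻¹ * x

    1<x : 1# < x
    1<x = ≰⇒> λ 1+p≤1 → <⇒≱ 0<p (+-cancelˡ-≤ 1# (≤-trans 1+p≤1 (≤-reflexive (sym (+-identityʳ 1#)))))

    0≤x : 0# ≤ x
    0≤x = ≤-trans 0≤1 (proj₁ 1<x)

    1≤p⁻¹ : 1# ≤ p ⁻¹
    1≤p⁻¹ = 1≤⁻¹ 0<p p≤1

    1≤β : 1# ≤ β
    1≤β = 1≤* 1≤p⁻¹ (proj₁ 1<x)

    p*β≈x : p * β ≈ x
    p*β≈x = trans (sym (*-assoc _ _ _)) (trans (*-congʳ (*-inverseʳ (>⇒≉ 0<p))) (*-identityˡ x))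

    -- The factor x ^ (k ⊓ N) pays for the sizes below N, where nothing is known about the balance.
    D : ℕ → Carrier
    D k = x ^ (k ⊓ N) * β ^ level k

    F : ℕ → Carrier
    F k = ι k * D k

    1≤D : ∀ k → 1# ≤ D k
    1≤D k = 1≤* (1≤^ (k ⊓ N) (proj₁ 1<x)) (1≤^ (level k) 1≤β)

    0≤D : ∀ k → 0# ≤ D k
    0≤D k = ≤-trans 0≤1 (1≤D k)

    1≤F : ∀ {k} → 1 ℕ.≤ k → 1# ≤ F k
    1≤F {k} 1≤k = 1≤* (1≤ι 1≤k) (1≤D k)

    x^*β^-mono-≤ : ∀ {a b c d} → a ℕ.≤ b → c ℕ.≤ d → x ^ a * β ^ c ≤ x ^ b * β ^ d
    x^*β^-mono-≤ {a} {d = d} a≤b c≤d = *-mono-≤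
      (^-nonNegative a 0≤x) (^-nonNegative d (≤-trans 0≤1 1≤β)) (^-monoʳ-≤ (proj₁ 1<x) a≤b) (^-monoʳ-≤ 1≤β c≤d)

    D-mono-≤ : ∀ {k n} → k ℕ.≤ n → D k ≤ D n
    D-mono-≤ {k} {n} k≤n = x^*β^-mono-≤ (ℕ.⊓-monoˡ-≤ N k≤n) (level-mono-≤ {k} {n} k≤n)

    -- Up to `N`, passing to a smaller size lowers the exponent `k ⊓ N`, which releases one factor
    -- x.
    x*D≤D : ∀ {k n} → k ℕ.< n → n ℕ.≤ N → x * D k ≤ D n
    x*D≤D {k} {n} k<n n≤N = begin
      x * (x ^ (k ⊓ N) * β ^ level k)  ≈⟨ *-assoc _ _ _ ⟨
      x ^ suc (k ⊓ N) * β ^ level k    ≤⟨ x^*β^-mono-≤ 1+k⊓N≤n⊓N (level-mono-≤ {k} {n} (ℕ.<⇒≤ k<n)) ⟩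
      x ^ (n ⊓ N) * β ^ level n        ∎
      where
      1+k⊓N≤n⊓N : suc (k ⊓ N) ℕ.≤ n ⊓ N
      1+k⊓N≤n⊓N = ℕ.≤-trans (s≤s (ℕ.m⊓n≤m k N)) (ℕ.≤-trans k<n (ℕ.≤-reflexive (≡.sym (ℕ.m≤n⇒m⊓n≡m n≤N))))

    -- The level drops by at least one, which releases a factor β, and x = p β.
    x*D≤p*D : ∀ {k n} → 2 ℕ.≤ n → k ℕ.≤ n → ι k ≤ (1# - γ) * ι n → x * D k ≤ p * D n
    x*D≤p*D {k} {n} 2≤n k≤n k≤[1-γ]n = begin
      x * (x ^ (k ⊓ N) * β ^ level k)       ≈⟨ *-congʳ p*β≈x ⟨
      p * β * (x ^ (k ⊓ N) * β ^ level k)   ≈⟨ solve 4 (λ p b s t → p :* b :* (s :* t) := p :* (s :* (b :* t))) refl p β (x ^ (k ⊓ N)) (β ^ level k) ⟩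
      p * (x ^ (k ⊓ N) * β ^ suc (level k)) ≤⟨ *-monoˡ-≤ (proj₁ 0<p) (x^*β^-mono-≤ (ℕ.⊓-monoˡ-≤ N k≤n) (level-drop {k} {n} 2≤n k≤[1-γ]n)) ⟩
      p * D n                               ∎

    -- The linear factor of `F` is there for this step: bounding the maximum of two heights by a sum
    -- produces two terms, and i + (n - i) = n recombines them without loss.
    x*[F+F]≤ : ∀ {i n v} → i ℕ.≤ n → x * D i ≤ v → x * D (n ∸ i) ≤ v → x * (F i + F (n ∸ i)) ≤ ι n * v
    x*[F+F]≤ {i} {n} {v} i≤n D≤ D′≤ = begin
      x * (ι i * D i + ι (n ∸ i) * D (n ∸ i))        ≈⟨ solve 5 (λ x i d j e → x :* (i :* d :+ j :* e) := i :* (x :* d) :+ j :* (x :* e)) refl x (ι i) (D i) (ι (n ∸ i)) (D (n ∸ i)) ⟩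
      ι i * (x * D i) + ι (n ∸ i) * (x * D (n ∸ i))  ≤⟨ +-mono-≤ (*-monoˡ-≤ (0≤ι i) D≤) (*-monoˡ-≤ (0≤ι (n ∸ i)) D′≤) ⟩
      ι i * v + ι (n ∸ i) * v                        ≈⟨ distribʳ _ _ _ ⟨
      (ι i + ι (n ∸ i)) * v                          ≈⟨ *-congʳ (ι-homo-+ i (n ∸ i)) ⟨
      ι (i ℕ.+ (n ∸ i)) * v                          ≡⟨ ≡.cong (λ m → ι m * v) (ℕ.m+[n∸m]≡n i≤n) ⟩
      ι n * v                                        ∎

    -- Any split costs at most x F(n), a balanced one at most p F(n) = x F(n) - F(n). Balanced
    -- splits of total weight at least p thus save p F(n), exactly the excess of x = 1 + p over 1.
    -- This saving is added to both sides.
    root-step-balanced : ∀ n → 2 ℕ.≤ n → n ℕ.≤ n₀ → N ℕ.≤ n →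
                         ∑[ i ∈ [1‥ n -1] ] (σ i (n ∸ i) * (x * (F i + F (n ∸ i)))) ≤ F n
    root-step-balanced n 2≤n n≤n₀ N≤n = +-cancelˡ-≤ (F n * p) (begin
      F n * p + S                             ≈⟨ +-comm _ _ ⟩
      S + F n * p                             ≤⟨ +-monoʳ-≤ S (*-monoˡ-≤ (*-nonNegative (0≤ι n) (0≤D n)) (balanced n N≤n n≤n₀)) ⟩
      S + F n * ∑ (balancedSplits γ n) f      ≡⟨ ≡.cong (λ is → S + F n * ∑ is f) (balancedSplits-filter n (ℕ.<⇒≤ 2≤n)) ⟩
      S + F n * ∑ (filter (balanced? n) [1‥ n -1]) f
        ≤⟨ ∑-filter-≤ (balanced? n) f g (x * F n) (F n) (All.map (λ {i} (1≤i , i<n) →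
             σ-nonNegative 1≤i i<n , unconditional i (ℕ.<⇒≤ i<n) , if-balanced i (ℕ.<⇒≤ i<n)) ([1‥-1]-bounds n)) ⟩
      x * F n * ∑ [1‥ n -1] f                 ≈⟨ trans (*-congˡ (sum≈1 n 2≤n)) (*-identityʳ _) ⟩
      x * F n                                 ≈⟨ solve 2 (λ p t → (con 1 :+ p) :* t := t :* p :+ t) refl p (F n) ⟩
      F n * p + F n                           ∎)
      where
      f g : ℕ → Carrier
      f i = σ i (n ∸ i)
      g i = x * (F i + F (n ∸ i))
      S = ∑[ i ∈ [1‥ n -1] ] (f i * g i)
      unconditional : ∀ i → i ℕ.≤ n → g i ≤ x * F n
      unconditional i i≤n = begin
        g i               ≤⟨ x*[F+F]≤ i≤n (*-monoˡ-≤ 0≤x (D-mono-≤ i≤n)) (*-monoˡ-≤ 0≤x (D-mono-≤ (ℕ.m∸n≤m n i))) ⟩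
        ι n * (x * D n)   ≈⟨ solve 3 (λ n x d → n :* (x :* d) := x :* (n :* d)) refl (ι n) x (D n) ⟩
        x * F n           ∎
      if-balanced : ∀ i → i ℕ.≤ n → Balanced n i → g i + F n ≤ x * F n
      if-balanced i i≤n bal = begin
        g i + F n               ≤⟨ +-monoˡ-≤ (F n) (x*[F+F]≤ i≤n (x*D≤p*D 2≤n i≤n (proj₂ bal)) (x*D≤p*D 2≤n (ℕ.m∸n≤m n i) (balanced-complement i≤n bal))) ⟩
        ι n * (p * D n) + F n   ≈⟨ solve 3 (λ n p d → n :* (p :* d) :+ n :* d := (con 1 :+ p) :* (n :* d)) refl (ι n) p (D n) ⟩
        x * F n                 ∎

    root-step-small : ∀ n → 2 ℕ.≤ n → n ℕ.≤ N →
                      ∑[ i ∈ [1‥ n -1] ] (σ i (n ∸ i) * (x * (F i + F (n ∸ i)))) ≤ F n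
    root-step-small n 2≤n n≤N = begin
      ∑[ i ∈ [1‥ n -1] ] (f i * (x * (F i + F (n ∸ i))))
        ≤⟨ ∑-mono-≤-local (All.map (λ {i} (1≤i , i<n) → ≤-trans
             (*-monoˡ-≤ (σ-nonNegative 1≤i i<n) (x*[F+F]≤ (ℕ.<⇒≤ i<n) (x*D≤D i<n n≤N) (x*D≤D (ℕ.∸-monoʳ-< 1≤i (ℕ.<⇒≤ i<n)) n≤N)))
             (≤-reflexive (*-comm _ _))) ([1‥-1]-bounds n)) ⟩
      ∑[ i ∈ [1‥ n -1] ] (F n * f i)   ≈⟨ ∑-*ˡ (F n) f [1‥ n -1] ⟩
      F n * ∑ [1‥ n -1] f              ≈⟨ trans (*-congˡ (sum≈1 n 2≤n)) (*-identityʳ _) ⟩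
      F n                              ∎
      where
      f : ℕ → Carrier
      f i = σ i (n ∸ i)

    root-step : ∀ n → 2 ℕ.≤ n → n ℕ.≤ n₀ →
                ∑[ i ∈ [1‥ n -1] ] (σ i (n ∸ i) * (x * (F i + F (n ∸ i)))) ≤ F n
    root-step n 2≤n n≤n₀ = [ root-step-balanced n 2≤n n≤n₀ , root-step-small n 2≤n ]′ (ℕ.≤-total N n)

    𝔼[x^height]≤F : ∀ d n → 1 ℕ.≤ n → n ℕ.≤ n₀ → 𝔼 d n (λ t → x ^ height t) ≤ F n
    𝔼[x^height]≤F d 1 1≤n n≤n₀ = ≤-trans (≤-reflexive (trans (+-identityʳ _) (*-identityʳ 1#))) (1≤F {1} 1≤n)
    -- At depth 0 no tree with two or more leaves is listed, so the sum is empty.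
    𝔼[x^height]≤F ℕ.zero n@(suc (suc m)) 1≤n n≤n₀ = ≤-trans 0≤1 (1≤F {n} 1≤n)
    𝔼[x^height]≤F (suc d) n@(suc (suc m)) 1≤n n≤n₀ = begin
      𝔼 (suc d) n X                                               ≈⟨ 𝔼-root d m X ⟩
      ∑[ i ∈ [1‥ n -1] ] 𝔼-split d i (n ∸ i) X                    ≤⟨ ∑-mono-≤-local (All.map (λ {i} (1≤i , i<n) → bound i 1≤i i<n) ([1‥-1]-bounds n)) ⟩
      ∑[ i ∈ [1‥ n -1] ] (σ i (n ∸ i) * (x * (F i + F (n ∸ i))))  ≤⟨ root-step n (s≤s (s≤s z≤n)) n≤n₀ ⟩
      F n                                                         ∎
      where
      X : 𝒯 → Carrier
      X t = x ^ height t
      bound : ∀ i → 1 ℕ.≤ i → i ℕ.< n → 𝔼-split d i (n ∸ i) X ≤ σ i (n ∸ i) * (x * (F i + F (n ∸ i)))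
      bound i 1≤i i<n = ≤-trans (𝔼-split-x^height (proj₁ 1<x) d i n 1≤i i<n)
        (*-monoˡ-≤ (σ-nonNegative 1≤i i<n) (*-monoˡ-≤ 0≤x (+-mono-≤
          (𝔼[x^height]≤F d i 1≤i (ℕ.≤-trans (ℕ.<⇒≤ i<n) n≤n₀))
          (𝔼[x^height]≤F d (n ∸ i) (ℕ.m<n⇒0<n∸m i<n) (ℕ.≤-trans (ℕ.m∸n≤m n i) n≤n₀)))))

    -- From the exponential moment to the expected height.

    height-bernoulli : ∀ m h → p * x ^ m * ι h ≤ p * x ^ m * ι m * 1# + x ^ h
    height-bernoulli m h with ℕ.≤-total h m
    ... | inj₁ h≤m = begin
      p * x ^ m * ι h               ≤⟨ *-monoˡ-≤ (*-nonNegative (proj₁ 0<p) (^-nonNegative m 0≤x)) (ι-mono-≤ h≤m) ⟩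
      p * x ^ m * ι m               ≈⟨ *-identityʳ _ ⟨
      p * x ^ m * ι m * 1#          ≤⟨ x≤x+y (^-nonNegative h 0≤x) ⟩
      p * x ^ m * ι m * 1# + x ^ h  ∎
    ... | inj₂ m≤h = begin
      p * x ^ m * ι h                                 ≡⟨ ≡.cong (λ k → p * x ^ m * ι k) m+e≡h ⟨
      p * x ^ m * ι (m ℕ.+ e)                         ≈⟨ *-congˡ (ι-homo-+ m e) ⟩
      p * x ^ m * (ι m + ι e)                         ≈⟨ solve 4 (λ p q m e → p :* q :* (m :+ e) := p :* q :* m :* con 1 :+ q :* (e :* p)) refl p (x ^ m) (ι m) (ι e) ⟩
      p * x ^ m * ι m * 1# + x ^ m * (ι e * p)        ≤⟨ +-monoʳ-≤ _ (*-monoˡ-≤ (^-nonNegative m 0≤x) (≤-trans (x≤y+x 0≤1) (bernoulli e (proj₁ 0<p)))) ⟩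
      p * x ^ m * ι m * 1# + x ^ m * x ^ e            ≈⟨ +-congˡ (^-homo-* x m e) ⟨
      p * x ^ m * ι m * 1# + x ^ (m ℕ.+ e)            ≡⟨ ≡.cong (λ k → p * x ^ m * ι m * 1# + x ^ k) m+e≡h ⟩
      p * x ^ m * ι m * 1# + x ^ h                    ∎
      where
      e = h ∸ m
      m+e≡h = ℕ.m+[n∸m]≡n m≤h

    -- Taking expectations in `height-bernoulli`, the constant term contributes at most m, since the
    -- mass is at most 1, and x^h at most `F n₀`, which is the additional 1 after division by p x^m.
    𝔼[H]≤ : ∀ m → 1 ℕ.≤ n₀ → F n₀ ≤ p * x ^ m → 𝔼[H] σ n₀ ≤ ι m + 1#
    𝔼[H]≤ m 1≤n₀ F≤c = *-cancelˡ-≤ (*-pos 0<p (^-pos m (<-≤-trans 0<1 (proj₁ 1<x)))) (begin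
      c * 𝔼[H] σ n₀                                                     ≈⟨ 𝔼-*ˡ n₀ n₀ c (λ t → ι (height t)) ⟨
      𝔼 n₀ n₀ (λ t → c * ι (height t))                                  ≤⟨ 𝔼-mono-≤ n₀ n₀ (λ t → height-bernoulli m (height t)) ⟩
      𝔼 n₀ n₀ (λ t → c * ι m * 1# + x ^ height t)                       ≈⟨ 𝔼-+ n₀ n₀ (λ _ → c * ι m * 1#) (λ t → x ^ height t) ⟩
      𝔼 n₀ n₀ (λ _ → c * ι m * 1#) + 𝔼 n₀ n₀ (λ t → x ^ height t)       ≤⟨ +-mono-≤ (≤-trans (≤-reflexive (𝔼-*ˡ n₀ n₀ (c * ι m) (λ _ → 1#))) (*-monoˡ-≤ 0≤cm (mass≤1 n₀ n₀))) (≤-trans (𝔼[x^height]≤F n₀ n₀ 1≤n₀ ℕ.≤-refl) F≤c) ⟩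
      c * ι m * 1# + c                                                  ≈⟨ solve 2 (λ c m → c :* m :* con 1 :+ c := c :* (m :+ con 1)) refl c (ι m) ⟩
      c * (ι m + 1#)                                                    ∎)
      where
      c = p * x ^ m
      0≤cm : 0# ≤ c * ι m
      0≤cm = *-nonNegative (*-nonNegative (proj₁ 0<p) (^-nonNegative m 0≤x)) (0≤ι m)

    -- Taking logarithms.

    threshold : ℕ
    threshold = proj₁ (⌈log⌉ 1<x (F n₀ * p ⁻¹))

    F≤p*x^threshold : F n₀ ≤ p * x ^ threshold
    F≤p*x^threshold = begin
      F n₀                  ≈⟨ x*y⁻¹*y≈x 0<p ⟨
      F n₀ * p ⁻¹ * p       ≤⟨ *-monoʳ-≤ (proj₁ 0<p) (proj₁ (proj₂ (⌈log⌉ 1<x (F n₀ * p ⁻¹)))) ⟩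
      x ^ threshold * p     ≈⟨ *-comm _ _ ⟩
      p * x ^ threshold     ∎

    A : Carrier
    A = log (ι 2 * p ⁻¹ * x)

    -- The summand 1 is log 2, and 2 β is the argument of the logarithm `A`.
    log-β+1≤A : log β + 1# ≤ A
    log-β+1≤A = begin
      log β + 1#          ≤⟨ +-monoʳ-≤ (log β) (≤-trans (≤-reflexive (sym (+-identityʳ 1#))) (2^n≤z⇒n≤log 1 (≤-reflexive (*-identityʳ (ι 2))))) ⟩
      log β + log (ι 2)   ≤⟨ log-*-≥ 1≤β (proj₁ 1<2) ⟩
      log (β * ι 2)       ≤⟨ log-mono-≤ (≤-trans 1≤β2 β2≤) 1≤β2 β2≤ ⟩
      A                   ∎
      where
      1≤β2 = 1≤* 1≤β (proj₁ 1<2)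
      β2≤ : β * ι 2 ≤ ι 2 * p ⁻¹ * x
      β2≤ = ≤-reflexive (trans (*-comm _ _) (sym (*-assoc _ _ _)))

    log-β≤A : log β ≤ A
    log-β≤A = ≤-trans (x≤x+y 0≤1) log-β+1≤A

    -- Both factors of β are at least 1, so each is at most β. Here and in `log-p⁻¹≤A` this turns
    -- lower-order terms into multiples of `A`.
    log-x≤A : log x ≤ A
    log-x≤A = ≤-trans (log-mono-≤ 1≤β (proj₁ 1<x) (begin
      x            ≈⟨ *-identityˡ x ⟨
      1# * x       ≤⟨ *-monoʳ-≤ 0≤x 1≤p⁻¹ ⟩
      p ⁻¹ * x     ∎)) log-β≤A

    log-p⁻¹≤A : log (p ⁻¹) ≤ A
    log-p⁻¹≤A = ≤-trans (log-mono-≤ 1≤β 1≤p⁻¹ (begin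
      p ⁻¹         ≈⟨ *-identityʳ _ ⟨
      p ⁻¹ * 1#    ≤⟨ *-monoˡ-≤ (≤-trans 0≤1 1≤p⁻¹) (proj₁ 1<x) ⟩
      p ⁻¹ * x     ∎)) log-β≤A

    log-F≤ : 1 ℕ.≤ n₀ → log (F n₀) ≤ log (ι n₀) + (ι N * log x + ι (level n₀) * log β)
    log-F≤ 1≤n₀ = begin
      log (F n₀)                                                           ≤⟨ log-*-≤ (1≤ι 1≤n₀) (1≤D n₀) ⟩
      log (ι n₀) + log (D n₀)                                              ≤⟨ +-monoʳ-≤ _ (log-*-≤ (1≤^ (n₀ ⊓ N) (proj₁ 1<x)) (1≤^ (level n₀) 1≤β)) ⟩
      log (ι n₀) + (log (x ^ (n₀ ⊓ N)) + log (β ^ level n₀))               ≤⟨ +-monoʳ-≤ _ (+-mono-≤ (log-^-≤ (n₀ ⊓ N) (proj₁ 1<x)) (log-^-≤ (level n₀) 1≤β)) ⟩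
      log (ι n₀) + (ι (n₀ ⊓ N) * log x + ι (level n₀) * log β)             ≤⟨ +-monoʳ-≤ _ (+-monoˡ-≤ _ (*-monoʳ-≤ (0≤log (proj₁ 1<x)) (ι-mono-≤ (ℕ.m⊓n≤n n₀ N)))) ⟩
      log (ι n₀) + (ι N * log x + ι (level n₀) * log β)                    ∎

    threshold*log≤ : 1 ℕ.≤ n₀ → ι threshold * log x ≤ log x + (log (F n₀) + log (p ⁻¹))
    threshold*log≤ 1≤n₀ = begin
      ι threshold * log x             ≤⟨ log-^-≥ threshold (proj₁ 1<x) ⟩
      log (x ^ threshold)             ≤⟨ log-mono-≤ (1≤* (proj₁ 1<x) 1≤F/p) (1≤^ threshold (proj₁ 1<x)) (y^⌈log⌉≤y*z 1<x 1≤F/p) ⟩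
      log (x * (F n₀ * p ⁻¹))         ≤⟨ log-*-≤ (proj₁ 1<x) 1≤F/p ⟩
      log x + log (F n₀ * p ⁻¹)       ≤⟨ +-monoʳ-≤ _ (log-*-≤ (1≤F 1≤n₀) 1≤p⁻¹) ⟩
      log x + (log (F n₀) + log (p ⁻¹)) ∎
      where
      1≤F/p : 1# ≤ F n₀ * p ⁻¹
      1≤F/p = 1≤* (1≤F 1≤n₀) 1≤p⁻¹

    -- The constant 4 + N counts error terms of at most `A` each: N from the sizes below `N`, and
    -- one each from rounding the threshold, from the 1 in `𝔼[H]≤`, from log (1/p) and from rounding
    -- the level.
    𝔼[H]*logs≤ : 1 ℕ.≤ n₀ → log y * log x * 𝔼[H] σ n₀ ≤ A * (log (ι n₀) + ι (4 ℕ.+ N))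
    𝔼[H]*logs≤ 1≤n₀ = begin
      c * l * 𝔼[H] σ n₀                       ≤⟨ *-monoˡ-≤ (*-nonNegative 0≤c 0≤l) (𝔼[H]≤ threshold 1≤n₀ F≤p*x^threshold) ⟩
      c * l * (ι threshold + 1#)              ≈⟨ solve 3 (λ c l m → c :* l :* (m :+ con 1) := c :* (m :* l :+ l)) refl c l (ι threshold) ⟩
      c * (ι threshold * l + l)               ≤⟨ *-monoˡ-≤ 0≤c (+-monoˡ-≤ l (≤-trans (threshold*log≤ 1≤n₀) (+-monoʳ-≤ l (+-monoˡ-≤ q (log-F≤ 1≤n₀))))) ⟩
      c * (l + (L + (ι N * l + j * B) + q) + l)
        ≈⟨ solve 7 (λ c l L n j B q → c :* (l :+ (L :+ (n :* l :+ j :* B) :+ q) :+ l) := B :* (j :* c) :+ c :* (L :+ ((con 1 :+ (con 1 :+ n)) :* l :+ q))) refl c l L (ι N) j B q ⟩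
      B * (j * c) + c * (L + (ι (2 ℕ.+ N) * l + q))
        ≤⟨ +-mono-≤ (*-monoˡ-≤ 0≤B (level*log≤ 1≤n₀)) (*-monoʳ-≤ 0≤rest c≤1) ⟩
      B * (c + L) + 1# * (L + (ι (2 ℕ.+ N) * l + q))
        ≤⟨ +-mono-≤ (*-monoˡ-≤ 0≤B (+-monoˡ-≤ L c≤1)) (*-monoˡ-≤ 0≤1 (+-monoʳ-≤ L (+-mono-≤ (*-monoˡ-≤ (0≤ι (2 ℕ.+ N)) log-x≤A) log-p⁻¹≤A))) ⟩
      B * (1# + L) + 1# * (L + (ι (2 ℕ.+ N) * A + A))
        ≈⟨ solve 4 (λ B L n A → B :* (con 1 :+ L) :+ con 1 :* (L :+ (n :* A :+ A)) := B :+ ((B :+ con 1) :* L :+ (con 1 :+ n) :* A)) refl B L (ι (2 ℕ.+ N)) A ⟩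
      B + ((B + 1#) * L + ι (3 ℕ.+ N) * A)
        -- The separate log n from the linear factor of `F` joins the level term here: (log β + 1)
        -- log n ≤ A log n.
        ≤⟨ +-mono-≤ log-β≤A (+-monoˡ-≤ _ (*-monoʳ-≤ 0≤L log-β+1≤A)) ⟩
      A + (A * L + ι (3 ℕ.+ N) * A)
        ≈⟨ solve 3 (λ A L n → A :+ (A :* L :+ n :* A) := A :* (L :+ (con 1 :+ n))) refl A L (ι (3 ℕ.+ N)) ⟩
      A * (L + ι (4 ℕ.+ N))                   ∎
      where
      c = log y
      l = log x
      L = log (ι n₀)
      B = log β
      q = log (p ⁻¹)
      j = ι (level n₀)
      0≤c = 0≤log (proj₁ 1<y)
      0≤l = 0≤log (proj₁ 1<x)
      0≤L = 0≤log (1≤ι 1≤n₀)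
      0≤B = 0≤log 1≤β
      c≤1 = z≤2⇒log≤1 (proj₁ 1<y) y≤2
      0≤rest : 0# ≤ L + (ι (2 ℕ.+ N) * l + q)
      0≤rest = +-nonNegative 0≤L (+-nonNegative (*-nonNegative (0≤ι (2 ℕ.+ N)) 0≤l) (0≤log 1≤p⁻¹))

    𝔼[H]-bound : 2 ℕ.≤ n₀ →
      𝔼[H] σ n₀ ≤ 1# / log y * (A / log x) * log (ι n₀) * (1# + ι (4 ℕ.+ N) * log (ι n₀) ⁻¹)
    𝔼[H]-bound 2≤n₀ = *-cancelˡ-≤ (*-pos 0<c 0<l) (begin
      c * l * 𝔼[H] σ n₀                                                   ≤⟨ 𝔼[H]*logs≤ (ℕ.<⇒≤ 2≤n₀) ⟩
      -- The ones are inserted to be expanded into c/c, l/l and L/L; the rest is a rearrangement of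
      -- factors.
      A * (L + K)                                                         ≈⟨ solve 3 (λ A L K → A :* (L :+ K) := con 1 :* con 1 :* (A :* (L :+ con 1 :* K))) refl A L K ⟩
      1# * 1# * (A * (L + 1# * K))                                        ≈⟨ *-cong (*-cong (inv 0<c) (inv 0<l)) (*-congˡ (+-congˡ (*-congʳ (inv 0<L)))) ⟨
      c * c ⁻¹ * (l * l ⁻¹) * (A * (L + L * L ⁻¹ * K))
        ≈⟨ solve 8 (λ c c′ l l′ A L L′ K → c :* c′ :* (l :* l′) :* (A :* (L :+ L :* L′ :* K)) := c :* l :* (con 1 :* c′ :* (A :* l′) :* L :* (con 1 :+ K :* L′)))
             refl c (c ⁻¹) l (l ⁻¹) A L (L ⁻¹) K ⟩
      c * l * (1# / c * (A / l) * L * (1# + K * L ⁻¹))                    ∎)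
      where
      c = log y
      l = log x
      L = log (ι n₀)
      K = ι (4 ℕ.+ N)
      0<c = 0<log 1<y
      0<l = 0<log 1<x
      0<L = 0<log (<-≤-trans 1<2 (ι-mono-≤ 2≤n₀))
      inv : ∀ {z} → 0# < z → z * z ⁻¹ ≈ 1#
      inv 0<z = *-inverseʳ (>⇒≉ 0<z)

theorem3p8 : {ℓ : Level} (ℝ : RealField ℓ) → let open RealField ℝ in let open TreeSource ℝ in
    (φ : ℕ → Carrier) →
    (∀ n → 1 ℕ.≤ n → 0# < φ n × φ n ≤ 1#) →
    (∀ m n → 1 ℕ.≤ m → m ℕ.≤ n → φ n ≤ φ m) →
    (γ : Carrier) → 0# < γ → γ < 1# / ι 2 →
    (N : ℕ) → 1 ℕ.≤ N →
    (σ : ℕ → ℕ → Carrier) → ℒ-wbal φ γ N σ →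
    𝔼[H] σ ≲ (λ n → 1# / log (1# / (1# - γ)) * (log (ι 2 * φ n ⁻¹ * (1# + φ n)) / log (1# + φ n)) * log (ι n))
theorem3p8 ℝ φ φ-range φ-decreasing γ 0<γ γ<½ N 1≤N σ σ-wbal =
  (λ n → ι (4 ℕ.+ N) * log (ι n) ⁻¹) ,
  Logarithm.c/log⟶0 ℝ (4 ℕ.+ N) (s≤s z≤n) ,
  -- From n = 2 on, log n is positive and the error term can be divided by it.
  2 , λ n 2≤n → TreeHeight.HeightBound.𝔼[H]-bound ℝ leafCentric 0<γ γ<½
    (proj₁ (φ-range n (ℕ.<⇒≤ 2≤n))) (proj₂ (φ-range n (ℕ.<⇒≤ 2≤n))) N n
    (λ k N≤k k≤n → ≤-trans (φ-decreasing k n (ℕ.≤-trans 1≤N N≤k) k≤n) (balanced k N≤k)) 2≤n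
  where
  open RealField ℝ
  open TreeSource.ℒ-wbal σ-wbal
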